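{- Consider the single load minimal cache demand problem with $c$ cores and total cache $K$. Call a job large if $a_j>\frac13$ and small otherwise. Algorithm $A_{4/3}$: build a graph $G$ with one vertex of weight $a_j$ for each large job $j$, plus artificial vertices of weight $0$ so that $G$ has exactly $2c$ vertices (fail if there are more than $2c$ large jobs), with an edge between two distinct vertices iff the sum of their weights is at most $1$; find a dominant perfect matching $Q$ of $G$ (fail if none is found) and, for each edge of $Q$, put the large jobs corresponding to its endpoints on a common core (different edges on different cores). Then process the small jobs in non-increasing order of cache demand, assigning them to cores taken in non-decreasing order of their current load (sum of large job loads), continuing on a core until its load exceeds $1$ and then moving to the next; allocate to each core the maximum cache demand of its jobs; fail if more than $c$ cores or more than $3K$ cache are used. If there is a solution assigning the jobs to $c$ cores with makespan at most $1$ and using $K$ cache, then $A_{4/3}$ assigns the jobs to $c$ cores with makespan at most $\frac43$ and uses at most $3K$ cache.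
   Context: Single load minimal cache demand problem: each job $j$ has a load $a_j>0$ and a minimal cache demand $x_j\ge0$. A solution is a cache partition $p$ giving $p(i)\ge0$ cache to each core (cache used $=\sum_ip(i)$) and an assignment $S$ of jobs to cores with $p(S(j))\ge x_j$ for every job; the makespan is the maximum over cores of the sum of $a_j$ of the jobs on the core. For a graph with weighted vertices, the weight of an edge is the sum of the weights of its endpoints; ties between edges of equal weight are broken by a fixed arbitrary order on the edges, so that for a perfect matching $A$ with $c$ edges the $i$-th heaviest edge $A_i$ is well defined. A perfect matching $A$ dominates a perfect matching $B$ if $\sum_{i=1}^xw(A_i)\ge\sum_{i=1}^xw(B_i)$ for all $x\in\{1,\dots,c\}$; a dominant perfect matching is one that dominates every perfect matching.
   Formalization: The job loads, the minimal cache demands, the cache amounts of the partition and the total cache K are taken to be rational numbers instead of real numbers. -}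

module Defs where

open import Data.Nat as ℕ using (ℕ)
open import Data.Integer using (+_)
open import Data.Rational using (ℚ; 0ℚ; 1ℚ; _+_; _*_; _≤_; _<_; _⊔_; _/_)
open import Data.Rational.Properties using (_<?_; ≤-decTotalOrder)
open import Data.Fin using (Fin; _≟_)
open import Data.Fin.Properties using () renaming (_≟_ to _≟ᶠ_)
open import Data.Bool using (Bool; true; false)
open import Data.Maybe using (Maybe; just; nothing)
import Data.Maybe as Maybe
open import Data.List using (List; []; _∷_; map; filter; foldr; take; reverse; allFin)
open import Data.List.Sort ≤-decTotalOrder using (sort)
open import Data.List.Membership.Propositional using (_∈_)
open import Data.List.Relation.Unary.Unique.Propositional using (Unique)
open import Data.List.Relation.Unary.Linked using (Linked)
open import Data.List.Relation.Binary.Permutation.Propositional using (_↭_)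
open import Data.Product using (Σ; ∃; _×_; _,_; proj₁; proj₂)
open import Function using (_∘_)
open import Function.Definitions using (Bijective)
open import Relation.Binary.PropositionalEquality using (_≡_; _≢_)
open import Relation.Nullary using (yes; no)

sumℚ : List ℚ → ℚ
sumℚ = foldr _+_ 0ℚ

-- maximum of a list of (non-negative) rationals; 0 for the empty list
maxℚ : List ℚ → ℚ
maxℚ = foldr _⊔_ 0ℚ

third : ℚ
third = + 1 / 3

fourThirds : ℚ
fourThirds = + 4 / 3

three : ℚ
three = + 3 / 1

coreLoad : {n c : ℕ} → (Fin n → ℚ) → (Fin n → Fin c) → Fin c → ℚ
coreLoad {n} a S i = sumℚ (map a (filter (λ j → S j ≟ i) (allFin n)))

Solution : (n c : ℕ) (a x : Fin n → ℚ) (K T : ℚ) → Set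
Solution n c a x K T =
  Σ (Fin c → ℚ) λ p → Σ (Fin n → Fin c) λ S →
    (∀ i → 0ℚ ≤ p i)
    × (∀ j → x j ≤ p (S j))
    × (sumℚ (map p (allFin c)) ≤ K)
    × (∀ i → coreLoad a S i ≤ T)

-- A perfect matching of a graph on 2c vertices: c edges (indexed by Fin c),
-- each an edge of the graph, such that every vertex is an endpoint of
-- exactly one edge exactly once (the endpoint map is a bijection).
endpoint : {c : ℕ} → (Fin c → Fin (2 ℕ.* c) × Fin (2 ℕ.* c)) → Fin c × Bool → Fin (2 ℕ.* c)
endpoint e (i , false) = proj₁ (e i)
endpoint e (i , true)  = proj₂ (e i)

record PerfectMatching (c : ℕ) (adj : Fin (2 ℕ.* c) → Fin (2 ℕ.* c) → Set) : Set where
  field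
    edge   : Fin c → Fin (2 ℕ.* c) × Fin (2 ℕ.* c)
    isEdge : ∀ i → adj (proj₁ (edge i)) (proj₂ (edge i))
    cover  : Bijective _≡_ _≡_ (endpoint edge)
open PerfectMatching public

edgeWeight : {c : ℕ} → (Fin (2 ℕ.* c) → ℚ) → Fin (2 ℕ.* c) × Fin (2 ℕ.* c) → ℚ
edgeWeight w (u , v) = w u + w v

-- edge weights of a matching, in non-increasing order: the i-th element is
-- w(A_i), the weight of the i-th heaviest edge (ties do not affect weights)
sortedWeights : {c : ℕ} {adj : Fin (2 ℕ.* c) → Fin (2 ℕ.* c) → Set} →
                (Fin (2 ℕ.* c) → ℚ) → PerfectMatching c adj → List ℚ
sortedWeights {c} w M = reverse (sort (map (edgeWeight {c} w ∘ edge M) (allFin c)))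

Dominates : {c : ℕ} {adj : Fin (2 ℕ.* c) → Fin (2 ℕ.* c) → Set} →
            (Fin (2 ℕ.* c) → ℚ) → PerfectMatching c adj → PerfectMatching c adj → Set
Dominates {c} w A B = ∀ (k : ℕ) → 1 ℕ.≤ k → k ℕ.≤ c →
  sumℚ (take k (sortedWeights w B)) ≤ sumℚ (take k (sortedWeights w A))

IsDominant : {c : ℕ} {adj : Fin (2 ℕ.* c) → Fin (2 ℕ.* c) → Set} →
             (Fin (2 ℕ.* c) → ℚ) → PerfectMatching c adj → Set
IsDominant {c} {adj} w A = ∀ (B : PerfectMatching c adj) → Dominates w A B

Large : {n : ℕ} → (Fin n → ℚ) → Fin n → Set
Large a j = third < a j

Small : {n : ℕ} → (Fin n → ℚ) → Fin n → Set
Small a j = a j ≤ third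

-- Step 1: the vertices of G are Fin (2c); a vertex labelled (just j) is the
-- vertex of large job j, a vertex labelled nothing is artificial (weight 0).
-- The labelling must be a bijection between the labelled vertices and the
-- large jobs. (Such a labelling exists iff there are at most 2c large jobs.)
record VertexLabelling (n c : ℕ) (a : Fin n → ℚ) : Set where
  field
    label      : Fin (2 ℕ.* c) → Maybe (Fin n)
    label-inj  : ∀ u v j → label u ≡ just j → label v ≡ just j → u ≡ v
    label-large : ∀ u j → label u ≡ just j → Large a j
    label-onto : ∀ j → Large a j → ∃ λ u → label u ≡ just j
open VertexLabelling public

atVertex : {n c : ℕ} {a : Fin n → ℚ} → VertexLabelling n c a →
           (Fin n → ℚ) → Fin (2 ℕ.* c) → ℚ
atVertex ℓ f u with label ℓ u
... | just j  = f j
... | nothing = 0ℚ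

vweight : {n c : ℕ} {a : Fin n → ℚ} → VertexLabelling n c a → Fin (2 ℕ.* c) → ℚ
vweight {a = a} ℓ = atVertex ℓ a

Adj : {n c : ℕ} {a : Fin n → ℚ} → VertexLabelling n c a →
      Fin (2 ℕ.* c) → Fin (2 ℕ.* c) → Set
Adj ℓ u v = u ≢ v × (vweight ℓ u + vweight ℓ v ≤ 1ℚ)

-- Step 2: matching Q; core i receives the large jobs at the endpoints of
-- edge i of Q.  Load of core i after the large jobs:
largeLoad : {n c : ℕ} {a : Fin n → ℚ} (ℓ : VertexLabelling n c a) →
            PerfectMatching c (Adj ℓ) → Fin c → ℚ
largeLoad {c = c} ℓ Q i = edgeWeight {c} (vweight ℓ) (edge Q i)

-- Step 3: greedy placement of small jobs. Arguments: current large-job load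
-- of each core, remaining cores in processing order, load added to the
-- current core so far, remaining small jobs in processing order.
-- The job goes on the current core; if that core's load now exceeds 1 we
-- move on to the next core. Returns nothing (failure) if a job remains
-- when all c cores are exhausted; otherwise the list of (job , core) pairs.
greedy : {n c : ℕ} → (Fin n → ℚ) → (Fin c → ℚ) → List (Fin c) → ℚ →
         List (Fin n) → Maybe (List (Fin n × Fin c))
greedy a L ks       acc []       = just []
greedy a L []       acc (j ∷ js) = nothing
greedy a L (k ∷ ks) acc (j ∷ js) with 1ℚ <? (L k + acc + a j)
... | yes _ = Maybe.map ((j , k) ∷_) (greedy a L ks 0ℚ js)
... | no  _ = Maybe.map ((j , k) ∷_) (greedy a L (k ∷ ks) (acc + a j) js)

SmallOrder : {n : ℕ} → (a x : Fin n → ℚ) → List (Fin n) → Set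
SmallOrder a x js =
  Unique js
  × (∀ j → j ∈ js → Small a j)
  × (∀ j → Small a j → j ∈ js)
  × Linked (λ j j' → x j' ≤ x j) js

CoreOrder : {c : ℕ} → (Fin c → ℚ) → List (Fin c) → Set
CoreOrder {c} L ks = (ks ↭ allFin c) × Linked (λ k k' → L k ≤ L k') ks

smallOn : {n c : ℕ} → List (Fin n × Fin c) → Fin c → List (Fin n)
smallOn res i = map proj₁ (filter (λ p → proj₂ p ≟ i) res)

finalLoad : {n c : ℕ} {a : Fin n → ℚ} (ℓ : VertexLabelling n c a) →
            PerfectMatching c (Adj ℓ) → List (Fin n × Fin c) → Fin c → ℚ
finalLoad {a = a} ℓ Q res i = largeLoad ℓ Q i + sumℚ (map a (smallOn res i))

finalCache : {n c : ℕ} {a : Fin n → ℚ} (ℓ : VertexLabelling n c a) →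
             PerfectMatching c (Adj ℓ) → (x : Fin n → ℚ) →
             List (Fin n × Fin c) → Fin c → ℚ
finalCache ℓ Q x res i =
  atVertex ℓ x (proj₁ (edge Q i)) ⊔ atVertex ℓ x (proj₂ (edge Q i))
  ⊔ maxℚ (map x (smallOn res i))

GoodRun : {n c : ℕ} (a x : Fin n → ℚ) (K : ℚ) (ℓ : VertexLabelling n c a) →
          PerfectMatching c (Adj ℓ) → List (Fin c) → List (Fin n) → Set
GoodRun {n} {c} a x K ℓ Q ks js =
  Σ (List (Fin n × Fin c)) λ res →
    (greedy a (largeLoad ℓ Q) ks 0ℚ js ≡ just res)
    × (∀ i → finalLoad ℓ Q res i ≤ fourThirds)
    × (sumℚ (map (finalCache ℓ Q x res) (allFin c)) ≤ three * K)

{-# OPTIONS --safe #-}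
module Submission where

-- A matching dominates another iff ∑ (w(e) − t)⁺ over its edges is at least as large for every t;
-- this form is additive in the edges. In a threshold graph, matching the heaviest vertex with its
-- heaviest admissible mate never decreases these sums, so iterating yields a dominant perfect
-- matching as soon as the given schedule supplies some perfect matching M.
--
-- A core of the schedule holds at most 2 large jobs, so the large jobs cost at most 2K cache. For
-- the small jobs, let f be the first one put on the m-th core. If fewer than m cores of the
-- schedule had cache at least x f, these would hold all small jobs up to f, which overfill the
-- first m − 1 cores of the algorithm; but by dominance no m − 1 cores of the schedule leave more
-- room beside M than the m − 1 lightest edges of Q. So the m-th largest cache of the schedule is
-- at least x f, and the first small jobs of all cores are charged to distinct cores, at total
-- cost K.

open import Defs
import Algebra.Definitions.RawMonoid
open import Data.Bool using (true; false)
open import Data.Fin as Fin using (Fin; toℕ; fromℕ<)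
import Data.Fin.Properties as Finₚ
open import Data.List using (List; []; _∷_; _++_; map; length; take; reverse; filter; concat; concatMap; mapMaybe; tabulate; lookup; allFin)
open import Data.List.Membership.Propositional using (_∈_; _∉_; find; lose)
open import Data.List.Membership.Propositional.Properties using (∈-∃++; ∈-allFin; ∈-filter⁺; ∈-filter⁻; ∈-++⁻; ∈-++⁺ˡ; ∈-++⁺ʳ; ∈-map⁺)
open import Data.List.Properties using (unfold-reverse; map-∘; map-tabulate; tabulate-lookup; length-map; length-tabulate; length-++; ++-assoc; ++-identityʳ; filter-accept; filter-reject)
open import Data.List.Relation.Binary.Permutation.Propositional as ↭ using (_↭_; swap; prep; ↭-refl; ↭-trans; ↭-sym; ↭-prep; ↭-reflexive; ↭⇒↭ₛ; module PermutationReasoning)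
open import Data.List.Relation.Binary.Permutation.Propositional.Properties using (↭-length; ↭-reverse; All-resp-↭; ∈-resp-↭; drop-∷; shift; shifts; ++-comm; ++⁺ˡ; ¬x∷xs↭[])
import Data.List.Relation.Binary.Permutation.Setoid.Properties as Permutationₛ
open import Data.List.Relation.Unary.All as All using (All; []; _∷_)
import Data.List.Relation.Unary.All.Properties as Allₚ
open import Data.List.Relation.Unary.AllPairs using (AllPairs; []; _∷_)
import Data.List.Relation.Unary.AllPairs.Properties as AllPairsₚ
open import Data.List.Relation.Unary.Any using (Any; here; there; any?)
open import Data.List.Relation.Unary.Linked.Properties using (Linked⇒AllPairs)
open import Data.List.Relation.Unary.Unique.Propositional using (Unique)
import Data.List.Relation.Unary.Unique.Propositional.Properties as Uniqueₚ
open import Data.List.Relation.Unary.Unique.Propositional.Properties using (allFin⁺)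
open import Data.Maybe as Maybe using (Maybe; just; nothing)
import Data.Maybe.Properties as Maybeₚ
open import Data.Nat as ℕ using (ℕ; zero; suc; z≤n; s≤s)
import Data.Nat.Properties as ℕₚ
open import Data.Product using (Σ; ∃; _×_; _,_; proj₁; proj₂)
open import Data.Rational using (ℚ; 0ℚ; 1ℚ; _+_; _-_; -_; _*_; _≤_; _<_; _⊔_; +-0-rawMonoid)
open import Data.Rational.Properties as ℚₚ using (module ≤-Reasoning)
open import Data.Rational.Solver using (module +-*-Solver)
open import Data.List.Sort ℚₚ.≤-decTotalOrder using (sort; sort-↭; sort-↗)
open import Data.Sum as Sum using (_⊎_; inj₁; inj₂)
open import Data.Unit using (⊤; tt)
open import Function using (_∘_; const; flip; id; case_of_)
open import Relation.Binary using (DecidableEquality)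
open import Relation.Binary.PropositionalEquality as ≡ using (_≡_; _≢_; refl; cong; cong₂; subst)
open import Relation.Nullary using (Dec; yes; no; ¬_; contradiction)
open import Relation.Unary using (Decidable)

open Algebra.Definitions.RawMonoid +-0-rawMonoid using () renaming (_×_ to _·_)
open +-*-Solver using (solve; _:=_; _:+_; _:-_; _:*_; con)

private variable
  A B : Set

-- Inequalities between rationals

-- Replacing `p` by `q` in `s + p ≡ r + q` and cancelling `q` gives the claim. Linear rearrangements
-- of an inequality go through this form, which leaves only an equation to the ring solver.
shift-≤ : ∀ {p q r s} → p ≤ q → s + p ≡ r + q → r ≤ s
shift-≤ {p} {q} {r} {s} p≤q eq = begin
  r           ≡⟨ solve 2 (λ r q → r := (r :+ q) :- q) refl r q ⟩
  r + q - q   ≡⟨ cong (_- q) eq ⟨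
  s + p - q   ≤⟨ ℚₚ.+-monoˡ-≤ (- q) (ℚₚ.+-monoʳ-≤ s p≤q) ⟩
  s + q - q   ≡⟨ solve 2 (λ r q → r := (r :+ q) :- q) refl s q ⟨
  s           ∎
  where open ≤-Reasoning

<⇒≱ : ∀ {p q} → p < q → ¬ (q ≤ p)
<⇒≱ p<q q≤p = ℚₚ.<-irrefl refl (ℚₚ.<-≤-trans p<q q≤p)

p≤q⇒0≤q-p : ∀ {p q} → p ≤ q → 0ℚ ≤ q - p
p≤q⇒0≤q-p {p} {q} p≤q = shift-≤ p≤q
  (solve 2 (λ p q → (q :- p) :+ p := con 0ℚ :+ q) refl p q)

p≤p+q : ∀ {p q} → 0ℚ ≤ q → p ≤ p + q
p≤p+q {p} {q} 0≤q = ≡.subst (_≤ p + q) (ℚₚ.+-identityʳ p) (ℚₚ.+-monoʳ-≤ p 0≤q)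

p≤q+p : ∀ {p q} → 0ℚ ≤ q → p ≤ q + p
p≤q+p {p} {q} 0≤q = ≡.subst (p ≤_) (ℚₚ.+-comm p q) (p≤p+q 0≤q)

0≤p+q : ∀ {p q} → 0ℚ ≤ p → 0ℚ ≤ q → 0ℚ ≤ p + q
0≤p+q 0≤p 0≤q = ℚₚ.≤-trans 0≤p (p≤p+q 0≤q)

-- Sums over lists

∑ : List A → (A → ℚ) → ℚ
∑ xs f = sumℚ (map f xs)

∑-++ : ∀ (xs ys : List A) f → ∑ (xs ++ ys) f ≡ ∑ xs f + ∑ ys f
∑-++ [] ys f = ≡.sym (ℚₚ.+-identityˡ _)
∑-++ (x ∷ xs) ys f = ≡.trans (cong (f x +_) (∑-++ xs ys f)) (≡.sym (ℚₚ.+-assoc (f x) _ _))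

∑-cong : ∀ (xs : List A) {f g : A → ℚ} → (∀ x → x ∈ xs → f x ≡ g x) → ∑ xs f ≡ ∑ xs g
∑-cong [] eq = refl
∑-cong (x ∷ xs) eq = cong₂ _+_ (eq x (here refl)) (∑-cong xs (λ y y∈ → eq y (there y∈)))

∑-mono : ∀ (xs : List A) {f g : A → ℚ} → (∀ x → x ∈ xs → f x ≤ g x) → ∑ xs f ≤ ∑ xs g
∑-mono [] le = ℚₚ.≤-refl
∑-mono (x ∷ xs) le = ℚₚ.+-mono-≤ (le x (here refl)) (∑-mono xs (λ y y∈ → le y (there y∈)))

∑-nonneg : ∀ (xs : List A) {f : A → ℚ} → (∀ x → x ∈ xs → 0ℚ ≤ f x) → 0ℚ ≤ ∑ xs f
∑-nonneg [] le = ℚₚ.≤-refl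
∑-nonneg (x ∷ xs) le = 0≤p+q (le x (here refl)) (∑-nonneg xs (λ y y∈ → le y (there y∈)))

∑-+ : ∀ (xs : List A) (f g : A → ℚ) → ∑ xs (λ x → f x + g x) ≡ ∑ xs f + ∑ xs g
∑-+ [] f g = ≡.sym (ℚₚ.+-identityˡ 0ℚ)
∑-+ (x ∷ xs) f g = ≡.trans (cong (f x + g x +_) (∑-+ xs f g))
  (solve 4 (λ a b c d → (a :+ b) :+ (c :+ d) := (a :+ c) :+ (b :+ d)) refl (f x) (g x) (∑ xs f) (∑ xs g))

∑-- : ∀ (xs : List A) (f g : A → ℚ) → ∑ xs (λ x → f x - g x) ≡ ∑ xs f - ∑ xs g
∑-- [] f g = ≡.sym (ℚₚ.+-inverseʳ 0ℚ)
∑-- (x ∷ xs) f g = ≡.trans (cong (f x - g x +_) (∑-- xs f g))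
  (solve 4 (λ a b c d → (a :- b) :+ (c :- d) := (a :+ c) :- (b :+ d)) refl (f x) (g x) (∑ xs f) (∑ xs g))

∑-const : ∀ (xs : List A) t → ∑ xs (const t) ≡ length xs · t
∑-const [] t = refl
∑-const (x ∷ xs) t = cong (t +_) (∑-const xs t)

∑-↭ : ∀ {xs ys : List A} (f : A → ℚ) → xs ↭ ys → ∑ xs f ≡ ∑ ys f
∑-↭ f ↭.refl = refl
∑-↭ f (prep x p) = cong (f x +_) (∑-↭ f p)
∑-↭ f (swap {xs} {ys} x y p) = ≡.trans (cong (λ s → f x + (f y + s)) (∑-↭ f p))
  (solve 3 (λ a b c → a :+ (b :+ c) := b :+ (a :+ c)) refl (f x) (f y) (∑ ys f))
∑-↭ f (↭.trans p q) = ≡.trans (∑-↭ f p) (∑-↭ f q)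

∑-map : ∀ (g : B → A) (xs : List B) (f : A → ℚ) → ∑ (map g xs) f ≡ ∑ xs (f ∘ g)
∑-map g xs f = cong sumℚ (≡.sym (map-∘ xs))

∑-concatMap : ∀ (g : B → List A) (xs : List B) (f : A → ℚ) →
              ∑ (concatMap g xs) f ≡ ∑ xs (λ x → ∑ (g x) f)
∑-concatMap g [] f = refl
∑-concatMap g (x ∷ xs) f = ≡.trans (∑-++ (g x) _ f) (cong (∑ (g x) f +_) (∑-concatMap g xs f))

-- Majorization through positive parts

pos : ℚ → ℚ
pos p = p ⊔ 0ℚ

0≤pos : ∀ p → 0ℚ ≤ pos p
0≤pos p = ℚₚ.p≤q⊔p p 0ℚ

p≤pos : ∀ p → p ≤ pos p
p≤pos p = ℚₚ.p≤p⊔q p 0ℚ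

p≤0⇒pos≡0 : ∀ {p} → p ≤ 0ℚ → pos p ≡ 0ℚ
p≤0⇒pos≡0 = ℚₚ.p≤q⇒p⊔q≡q

0≤p⇒pos≡p : ∀ {p} → 0ℚ ≤ p → pos p ≡ p
0≤p⇒pos≡p = ℚₚ.p≥q⇒p⊔q≡p

p≤q⇒p-q≤0 : ∀ {p q} → p ≤ q → p - q ≤ 0ℚ
p≤q⇒p-q≤0 {p} {q} p≤q = shift-≤ p≤q
  (solve 2 (λ p q → con 0ℚ :+ p := (p :- q) :+ q) refl p q)

-- A number is the difference of its positive and negative parts. This turns excess above a
-- threshold into slack below it.
pos-flip : ∀ p q → pos (p - q) ≡ pos (q - p) + (p - q)
pos-flip p q with ℚₚ.≤-total p q
... | inj₁ p≤q = begin
  pos (p - q)              ≡⟨ p≤0⇒pos≡0 (p≤q⇒p-q≤0 p≤q) ⟩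
  0ℚ                       ≡⟨ solve 2 (λ p q → con 0ℚ := (q :- p) :+ (p :- q)) refl p q ⟩
  q - p + (p - q)          ≡⟨ cong (_+ (p - q)) (0≤p⇒pos≡p (p≤q⇒0≤q-p p≤q)) ⟨
  pos (q - p) + (p - q)    ∎
  where open ≡.≡-Reasoning
... | inj₂ q≤p = begin
  pos (p - q)              ≡⟨ 0≤p⇒pos≡p (p≤q⇒0≤q-p q≤p) ⟩
  p - q                    ≡⟨ ℚₚ.+-identityˡ (p - q) ⟨
  0ℚ + (p - q)             ≡⟨ cong (_+ (p - q)) (p≤0⇒pos≡0 (p≤q⇒p-q≤0 q≤p)) ⟨
  pos (q - p) + (p - q)    ∎
  where open ≡.≡-Reasoning

-- Conjugate to the prefix sums of the sorted list: the sum of the k largest entries is the minimum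
-- over t of `k · t + excess t ws`. Unlike prefix sums, it does not depend on the order of the list.
excess : ℚ → List ℚ → ℚ
excess t ws = ∑ ws (λ w → pos (w - t))

-- Convexity of `pos`: both y lie between `z₂` and `z₁` and have the same sum. If one y is at most
-- 0, the other is bounded by `z₁` alone; otherwise the left side is the common sum.
pos-exchange : ∀ {y₁ y₂ z₁ z₂} → y₁ + y₂ ≡ z₁ + z₂ → y₁ ≤ z₁ → y₂ ≤ z₁ →
               pos y₁ + pos y₂ ≤ pos z₁ + pos z₂
pos-exchange {y₁} {y₂} {z₁} {z₂} eq y₁≤z₁ y₂≤z₁ with ℚₚ.≤-total y₁ 0ℚ | ℚₚ.≤-total y₂ 0ℚ
... | inj₁ y₁≤0 | _ rewrite ℚₚ.p≤q⇒p⊔q≡q y₁≤0 | ℚₚ.+-identityˡ (pos y₂) =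
  ℚₚ.≤-trans (ℚₚ.⊔-monoˡ-≤ 0ℚ y₂≤z₁) (p≤p+q (0≤pos z₂))
... | inj₂ _ | inj₁ y₂≤0 rewrite ℚₚ.p≤q⇒p⊔q≡q y₂≤0 | ℚₚ.+-identityʳ (pos y₁) =
  ℚₚ.≤-trans (ℚₚ.⊔-monoˡ-≤ 0ℚ y₁≤z₁) (p≤p+q (0≤pos z₂))
... | inj₂ 0≤y₁ | inj₂ 0≤y₂ rewrite ℚₚ.p≥q⇒p⊔q≡p 0≤y₁ | ℚₚ.p≥q⇒p⊔q≡p 0≤y₂ | eq =
  ℚₚ.+-mono-≤ (p≤pos z₁) (p≤pos z₂)

-- Each of the k entries is at most `t` plus its positive part above `t`, and the entries not taken
-- only add non-negative terms.
sum-take≤excess : ∀ t k (ws : List ℚ) → k ℕ.≤ length ws → sumℚ (take k ws) ≤ k · t + excess t ws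
sum-take≤excess t zero ws _ = 0≤p+q ℚₚ.≤-refl (∑-nonneg ws (λ w _ → 0≤pos (w - t)))
sum-take≤excess t (suc k) (w ∷ ws) (s≤s k≤) = begin
  w + sumℚ (take k ws)                           ≡⟨ cong (_+ sumℚ (take k ws)) (solve 2 (λ w t → w := t :+ (w :- t)) refl w t) ⟩
  t + (w - t) + sumℚ (take k ws)                 ≤⟨ ℚₚ.+-mono-≤ (ℚₚ.+-monoʳ-≤ t (p≤pos (w - t))) (sum-take≤excess t k ws k≤) ⟩
  t + pos (w - t) + (k · t + excess t ws)        ≡⟨ solve 4 (λ a b c d → (a :+ b) :+ (c :+ d) := (a :+ c) :+ (b :+ d)) refl t (pos (w - t)) (k · t) (excess t ws) ⟩
  t + k · t + (pos (w - t) + excess t ws)        ∎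
  where open ≤-Reasoning

Descending : List ℚ → Set
Descending = AllPairs (flip _≤_)

excess-zero : ∀ {t ws} → All (_≤ t) ws → excess t ws ≡ 0ℚ
excess-zero [] = refl
excess-zero {t} {w ∷ ws} (w≤t ∷ ws≤t) = cong₂ _+_
  (p≤0⇒pos≡0 (p≤q⇒p-q≤0 w≤t))
  (excess-zero ws≤t)

excess-head : ∀ {t w ws} → t ≤ w → excess t (w ∷ ws) ≡ w - t + excess t ws
excess-head {t} {w} {ws} t≤w = cong (_+ excess t ws) (0≤p⇒pos≡p (p≤q⇒0≤q-p t≤w))

-- Equality holds when `t` is the k-th entry, which separates the entries taken from the others.
-- Membership of `t` in the list is carried along because it yields `t ≤ w` for the next head `w`.
sum-take-attains : ∀ {ws} → Descending ws → ∀ k → 1 ℕ.≤ k → k ℕ.≤ length ws →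
                   ∃ λ t → t ∈ ws × sumℚ (take k ws) ≡ k · t + excess t ws
sum-take-attains {w ∷ ws} (w≥ ∷ _) (suc zero) _ _ = w , here refl ,
  ≡.trans (≡.sym (ℚₚ.+-identityʳ (w + 0ℚ)))
    (cong (w + 0ℚ +_) (≡.sym (excess-zero {w} {w ∷ ws} (ℚₚ.≤-refl ∷ w≥))))
sum-take-attains {w ∷ ws} (w≥ ∷ ws↘) (suc (suc k)) _ (s≤s k≤)
  with t , t∈ , eq ← sum-take-attains ws↘ (suc k) (s≤s z≤n) k≤ = t , there t∈ , (begin
    w + sumℚ (take (suc k) ws)             ≡⟨ cong (w +_) eq ⟩
    w + (suc k · t + excess t ws)          ≡⟨ solve 4 (λ w t k e → w :+ (k :+ e) := (t :+ k) :+ ((w :- t) :+ e)) refl w t (suc k · t) (excess t ws) ⟩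
    t + suc k · t + (w - t + excess t ws)  ≡⟨ cong (t + suc k · t +_) (excess-head {ws = ws} (All.lookup w≥ t∈)) ⟨
    t + suc k · t + excess t (w ∷ ws)      ∎)
  where open ≡.≡-Reasoning

-- Take for k the length of the prefix lying above `t`; entries equal to `t` contribute 0 whether
-- counted or not.
excess-attains : ∀ {ws} → Descending ws → ∀ t →
                 ∃ λ k → k ℕ.≤ length ws × k · t + excess t ws ≡ sumℚ (take k ws)
excess-attains {[]} _ t = 0 , z≤n , refl
excess-attains {w ∷ ws} (w≥ ∷ ws↘) t with ℚₚ.≤-total w t
... | inj₁ w≤t = 0 , z≤n ,
  cong (0ℚ +_) (excess-zero (w≤t ∷ All.map (λ v≤w → ℚₚ.≤-trans v≤w w≤t) w≥))
... | inj₂ t≤w with k , k≤ , eq ← excess-attains ws↘ t = suc k , s≤s k≤ , (begin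
    t + k · t + excess t (w ∷ ws)      ≡⟨ cong (t + k · t +_) (excess-head {ws = ws} t≤w) ⟩
    t + k · t + (w - t + excess t ws)  ≡⟨ solve 4 (λ w t k e → (t :+ k) :+ ((w :- t) :+ e) := w :+ (k :+ e)) refl w t (k · t) (excess t ws) ⟩
    w + (k · t + excess t ws)          ≡⟨ cong (w +_) eq ⟩
    w + sumℚ (take k ws)               ∎)
  where open ≡.≡-Reasoning

-- Choose the k that is tight for `vs` at `t`; the same k gives a lower bound on the excess of `ws`.
sum-take-mono⇒excess-mono : ∀ {vs ws} → Descending vs → length vs ≡ length ws →
  (∀ k → 1 ℕ.≤ k → k ℕ.≤ length ws → sumℚ (take k vs) ≤ sumℚ (take k ws)) →
  ∀ t → excess t vs ≤ excess t ws
sum-take-mono⇒excess-mono {vs} {ws} vs↘ len le t with k , k≤ , eq ← excess-attains vs↘ t =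
  shift-≤ (ℚₚ.≤-trans (le′ k (subst (k ℕ.≤_) len k≤)) (sum-take≤excess t k ws (subst (k ℕ.≤_) len k≤)))
    (≡.trans (cong (excess t ws +_) (≡.sym eq))
      (solve 3 (λ a b c → a :+ (c :+ b) := b :+ (c :+ a)) refl (excess t ws) (excess t vs) (k · t)))
  where
    -- The tight k may be 0, which the hypothesis does not cover; both prefix sums are then 0.
    le′ : ∀ k → k ℕ.≤ length ws → sumℚ (take k vs) ≤ sumℚ (take k ws)
    le′ zero _ = ℚₚ.≤-refl
    le′ (suc k) = le (suc k) (s≤s z≤n)

-- The dual choice: the `t` that is tight for `ws` at k bounds the prefix sum of `vs`.
excess-mono⇒sum-take-mono : ∀ {vs ws} → Descending ws → length vs ≡ length ws →
  (∀ t → excess t vs ≤ excess t ws) →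
  ∀ k → 1 ℕ.≤ k → k ℕ.≤ length ws → sumℚ (take k vs) ≤ sumℚ (take k ws)
excess-mono⇒sum-take-mono {vs} {ws} ws↘ len le k 1≤k k≤ with t , _ , eq ← sum-take-attains ws↘ k 1≤k k≤ = begin
  sumℚ (take k vs)      ≤⟨ sum-take≤excess t k vs (subst (k ℕ.≤_) (≡.sym len) k≤) ⟩
  k · t + excess t vs   ≤⟨ ℚₚ.+-monoʳ-≤ (k · t) (le t) ⟩
  k · t + excess t ws   ≡⟨ eq ⟨
  sumℚ (take k ws)      ∎
  where open ≤-Reasoning

reverse-descending : ∀ {ws} → AllPairs _≤_ ws → Descending (reverse ws)
reverse-descending [] = []
reverse-descending {w ∷ ws} (w≤ ∷ ws↗) rewrite unfold-reverse w ws =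
  AllPairsₚ.++⁺ (reverse-descending ws↗) ([] ∷ [])
    (All.map (_∷ []) (All-resp-↭ (↭-sym (↭-reverse ws)) w≤))

-- Optimal edge lists in threshold graphs

∈⇒↭ : ∀ {x : A} {xs} → x ∈ xs → ∃ λ ys → xs ↭ x ∷ ys
∈⇒↭ {x = x} x∈xs with ys , zs , refl ← ∈-∃++ x∈xs = ys ++ zs , shift x ys zs

-- An edge list stands for a perfect matching of `vs` when its flattening is a permutation of `vs`.
-- Vertices can then be removed without renumbering the others.
flatten : List (A × A) → List A
flatten [] = []
flatten ((u , v) ∷ es) = u ∷ v ∷ flatten es

heaviest : ∀ (w : A → ℚ) {P : A → Set} → Decidable P → ∀ xs → Any P xs →
           ∃ λ v → v ∈ xs × P v × (∀ y → y ∈ xs → P y → w y ≤ w v)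
heaviest w {P} P? (x ∷ xs) any with any? P? xs | any
... | no ¬any | here px = x , here refl , px , λ where
  _ (here refl) _ → ℚₚ.≤-refl
  y (there y∈) py → contradiction (lose y∈ py) ¬any
... | no ¬any | there any′ = contradiction any′ ¬any
... | yes any′ | _ with v , v∈ , pv , max ← heaviest w P? xs any′ | P? x
...   | no ¬px = v , there v∈ , pv , λ where
  _ (here refl) px → contradiction px ¬px
  y (there y∈) py → max y y∈ py
...   | yes px with ℚₚ.≤-total (w x) (w v)
...     | inj₁ x≤v = v , there v∈ , pv , λ where
  _ (here refl) _ → x≤v
  y (there y∈) py → max y y∈ py
...     | inj₂ v≤x = x , here refl , px , λ where
  _ (here refl) _ → ℚₚ.≤-refl
  y (there y∈) py → ℚₚ.≤-trans (max y y∈ py) v≤x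

module Threshold (w : A → ℚ) where

  pairWeight : A × A → ℚ
  pairWeight (u , v) = w u + w v

  Fits : List (A × A) → Set
  Fits = All (λ e → pairWeight e ≤ 1ℚ)

  pairExcess : ℚ → List (A × A) → ℚ
  pairExcess t es = excess t (map pairWeight es)

  -- Brings the edge at `v` to the front, oriented to start at `v`. Only the order of the edges and
  -- the orientation of one edge change, so admissibility and all excesses survive.
  record Extraction (v : A) (es : List (A × A)) : Set where
    constructor extraction
    field
      mate    : A
      rest    : List (A × A)
      vertices : flatten es ↭ v ∷ mate ∷ flatten rest
      fits    : Fits es → Fits ((v , mate) ∷ rest)
      excess≡ : ∀ t → pairExcess t es ≡ pairExcess t ((v , mate) ∷ rest)

  extract : ∀ {v} es → v ∈ flatten es → Extraction v es
  extract ((u , a) ∷ es) (here refl) = extraction a es ↭-refl (λ f → f) (λ _ → refl)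
  extract ((a , u) ∷ es) (there (here refl)) = extraction a es (swap a u ↭-refl)
    (λ { (le ∷ fs) → subst (_≤ 1ℚ) (ℚₚ.+-comm (w a) (w u)) le ∷ fs })
    (λ t → cong (λ s → pos (s - t) + pairExcess t es) (ℚₚ.+-comm (w a) (w u)))
  extract {v} ((a , b) ∷ es) (there (there v∈)) with extraction m r p f e ← extract es v∈ =
    extraction m ((a , b) ∷ r) perm
      (λ { (le ∷ fs) → case (f fs) of λ { (le′ ∷ fs′) → le′ ∷ le ∷ fs′ } })
      (λ t → ≡.trans (cong (pos (w a + w b - t) +_) (e t))
        (solve 3 (λ x y z → x :+ (y :+ z) := y :+ (x :+ z)) refl
          (pos (w a + w b - t)) (pos (w v + w m - t)) (pairExcess t r)))
    where
      open PermutationReasoning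
      perm : a ∷ b ∷ flatten es ↭ v ∷ m ∷ a ∷ b ∷ flatten r
      perm = begin
        a ∷ b ∷ flatten es          ↭⟨ ↭-prep a (↭-prep b p) ⟩
        (a ∷ b ∷ []) ++ v ∷ m ∷ flatten r ↭⟨ shift v (a ∷ b ∷ []) (m ∷ flatten r) ⟩
        v ∷ (a ∷ b ∷ []) ++ m ∷ flatten r ↭⟨ ↭-prep v (shift m (a ∷ b ∷ []) (flatten r)) ⟩
        v ∷ m ∷ a ∷ b ∷ flatten r   ∎

  -- Since v is heaviest and u is its heaviest admissible mate, replacing the edges va and ub by
  -- vu and ab keeps a perfect matching and spreads the weights further apart.
  exchange : ∀ {v u vs} →
    (∀ y → y ∈ u ∷ vs → w y ≤ w v) →
    (∀ y → y ∈ u ∷ vs → w v + w y ≤ 1ℚ → w y ≤ w u) →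
    w v + w u ≤ 1ℚ →
    ∀ es → flatten es ↭ v ∷ u ∷ vs → Fits es →
    ∃ λ es′ → flatten es′ ↭ vs × Fits es′ ×
              (∀ t → pairExcess t es ≤ pairExcess t ((v , u) ∷ es′))
  exchange {v} {u} {vs} v-max u-max vu≤1 es es↭ fs
    with extraction a es₁ p f e ← extract es (∈-resp-↭ (↭-sym es↭) (here refl))
    with va≤1 ∷ fs₁ ← f fs
    with q ← drop-∷ (↭-trans (↭-sym p) es↭)
    with ∈-resp-↭ (↭-sym q) (here refl)
  -- The mate of `v` is already `u`, so there is nothing to exchange.
  ... | here refl = es₁ , drop-∷ q , fs₁ , λ t → ℚₚ.≤-reflexive (e t)
  ... | there u∈ with extraction b es₂ p₂ f₂ e₂ ← extract es₁ u∈
    with ub≤1 ∷ fs₂ ← f₂ fs₁ =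
    (a , b) ∷ es₂ , drop-∷ perm , ab≤1 ∷ fs₂ , excess≤
    where
      perm : u ∷ a ∷ b ∷ flatten es₂ ↭ u ∷ vs
      perm = ↭-trans (swap u a ↭-refl) (↭-trans (↭-prep a (↭-sym p₂)) q)
      a≤u : w a ≤ w u
      a≤u = u-max a (∈-resp-↭ perm (there (here refl))) va≤1
      b≤v : w b ≤ w v
      b≤v = v-max b (∈-resp-↭ perm (there (there (here refl))))
      -- The threshold structure enters here: `ub` is admissible, and replacing `u` by the lighter
      -- or equal `a` keeps it so.
      ab≤1 : w a + w b ≤ 1ℚ
      ab≤1 = ℚₚ.≤-trans (ℚₚ.+-monoˡ-≤ (w b) a≤u) ub≤1
      excess≤ : ∀ t → pairExcess t es ≤ pairExcess t ((v , u) ∷ (a , b) ∷ es₂)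
      excess≤ t = begin
        pairExcess t es                                              ≡⟨ e t ⟩
        pos (w v + w a - t) + pairExcess t es₁                       ≡⟨ cong (pos (w v + w a - t) +_) (e₂ t) ⟩
        pos (w v + w a - t) + (pos (w u + w b - t) + pairExcess t es₂) ≡⟨ ℚₚ.+-assoc (pos (w v + w a - t)) _ _ ⟨
        pos (w v + w a - t) + pos (w u + w b - t) + pairExcess t es₂ ≤⟨ ℚₚ.+-monoˡ-≤ (pairExcess t es₂) (pos-exchange
            {w v + w a - t} {w u + w b - t} {w v + w u - t} {w a + w b - t}
            (solve 5 (λ v a u b t → ((v :+ a) :- t) :+ ((u :+ b) :- t) := ((v :+ u) :- t) :+ ((a :+ b) :- t)) refl (w v) (w a) (w u) (w b) t)
            (ℚₚ.+-monoˡ-≤ (- t) (ℚₚ.+-monoʳ-≤ (w v) a≤u))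
            (ℚₚ.+-monoˡ-≤ (- t) (subst (_≤ w v + w u) (ℚₚ.+-comm (w b) (w u)) (ℚₚ.+-monoˡ-≤ (w u) b≤v)))) ⟩
        pos (w v + w u - t) + pos (w a + w b - t) + pairExcess t es₂ ≡⟨ ℚₚ.+-assoc (pos (w v + w u - t)) _ _ ⟩
        pairExcess t ((v , u) ∷ (a , b) ∷ es₂)                       ∎
        where open ≤-Reasoning

  Optimal : List (A × A) → List A → Set
  Optimal es vs = ∀ es′ → flatten es′ ↭ vs → Fits es′ → ∀ t → pairExcess t es′ ≤ pairExcess t es

  -- By `exchange`, every competitor can be changed to contain the edge `vu` without losing excess
  -- at any t. What remains is a comparison on the other vertices, settled by induction on their
  -- number `n`.
  optimal-exists : ∀ n es → length (flatten es) ≡ n → Fits es →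
                   ∃ λ es* → flatten es* ↭ flatten es × Fits es* × Optimal es* (flatten es)
  optimal-exists _ [] _ _ = [] , ↭-refl , [] , λ where
    [] _ _ _ → ℚₚ.≤-refl
    (_ ∷ _) p _ _ → contradiction p ¬x∷xs↭[]
  optimal-exists (suc (suc n)) es@(_ ∷ _) len fs
    with v , v∈ , _ , v-max ← heaviest w {const ⊤} (λ _ → yes tt) (flatten es) (here tt)
    with extraction m r p f _ ← extract es v∈
    with vm≤1 ∷ _ ← f fs
    -- The mate `m` of `v` in `es` shows that `v` has an admissible mate at all.
    with u , u∈ , vu≤1 , u-max ← heaviest w (λ y → w v + w y ℚₚ.≤? 1ℚ) (m ∷ flatten r) (here vm≤1)
    with vs , q ← ∈⇒↭ u∈
    with es↭ ← ↭-trans p (↭-prep v q)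
    with exch ← exchange {v} {u} {vs}
           (λ y y∈ → v-max y (∈-resp-↭ (↭-sym es↭) (there y∈)) tt)
           (λ y y∈ → u-max y (∈-resp-↭ (↭-sym q) y∈)) vu≤1
    -- Applied to `es` itself, the exchange leaves an admissible perfect matching of the other
    -- vertices, on which the recursion runs.
    with es₀ , es₀↭ , fs₀ , _ ← exch es es↭ fs
    with es* , es*↭ , fs* , opt ← optimal-exists n es₀
           (ℕₚ.suc-injective (ℕₚ.suc-injective (≡.trans (cong (suc ∘ suc) (↭-length es₀↭)) (≡.trans (≡.sym (↭-length es↭)) len)))) fs₀ =
    (v , u) ∷ es* ,
    ↭-trans (↭-prep v (↭-prep u (↭-trans es*↭ es₀↭))) (↭-sym es↭) ,
    vu≤1 ∷ fs* ,
    λ es′ es′↭ fs′ t → let es″ , es″↭ , fs″ , le = exch es′ (↭-trans es′↭ es↭) fs′ in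
      ℚₚ.≤-trans (le t)
        (ℚₚ.+-monoʳ-≤ (pos (w v + w u - t)) (opt es″ (↭-trans es″↭ (↭-sym es₀↭)) fs″ t))

-- Perfect matchings as edge lists

Unique-resp-↭ : {xs ys : List A} → xs ↭ ys → Unique xs → Unique ys
Unique-resp-↭ p = Permutationₛ.Unique-resp-↭ (≡.setoid _) (↭⇒↭ₛ p)

-- The surplus `zs` is explicit: counting arguments show it to be empty, and sums bound it below by
-- 0.
unique-⊆⇒↭ : ∀ {xs ys : List A} → Unique xs → (∀ x → x ∈ xs → x ∈ ys) → ∃ λ zs → ys ↭ xs ++ zs
unique-⊆⇒↭ {ys = ys} [] _ = ys , ↭-refl
unique-⊆⇒↭ {xs = x ∷ xs} (x∉ ∷ u) sub with ys′ , p ← ∈⇒↭ (sub x (here refl)) =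
  let zs , q = unique-⊆⇒↭ u sub′ in zs , ↭-trans p (↭-prep x q)
  where
    sub′ : ∀ y → y ∈ xs → y ∈ ys′
    sub′ y y∈ with ∈-resp-↭ p (sub y (there y∈))
    ... | here refl = contradiction refl (All.lookup x∉ y∈)
    ... | there y∈′ = y∈′

length-flatten : (es : List (A × A)) → length (flatten es) ≡ 2 ℕ.* length es
length-flatten [] = refl
length-flatten (e ∷ es) = ≡.trans (cong (suc ∘ suc) (length-flatten es)) (≡.sym (ℕₚ.*-suc 2 (length es)))

∑-flatten-map : ∀ (e : B → A × A) is f →
                ∑ (flatten (map e is)) f ≡ ∑ is (λ i → f (proj₁ (e i)) + f (proj₂ (e i)))
∑-flatten-map e [] f = refl
∑-flatten-map e (i ∷ is) f = ≡.trans (cong (λ s → f (proj₁ (e i)) + (f (proj₂ (e i)) + s)) (∑-flatten-map e is f))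
  (≡.sym (ℚₚ.+-assoc (f (proj₁ (e i))) (f (proj₂ (e i))) _))

length-allFin : ∀ c → length (allFin c) ≡ c
length-allFin c = length-tabulate id

as-image : ∀ {c} (xs : List A) → length xs ≡ c → ∃ λ (f : Fin c → A) → map f (allFin c) ≡ xs
as-image xs refl = lookup xs , ≡.trans (map-tabulate id (lookup xs)) (tabulate-lookup xs)

module _ {c : ℕ} where

  private
    V : Set
    V = Fin (2 ℕ.* c)

  endpoint-∈ : ∀ (e : Fin c → V × V) {i is} b → i ∈ is → endpoint e (i , b) ∈ flatten (map e is)
  endpoint-∈ e false (here refl) = here refl
  endpoint-∈ e true (here refl) = there (here refl)
  endpoint-∈ e b (there i∈) = there (there (endpoint-∈ e b i∈))

  ∈-endpoint : ∀ (e : Fin c → V × V) {v} is → v ∈ flatten (map e is) → ∃ λ ib → endpoint e ib ≡ v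
  ∈-endpoint e (i ∷ is) (here refl) = (i , false) , refl
  ∈-endpoint e (i ∷ is) (there (here refl)) = (i , true) , refl
  ∈-endpoint e (i ∷ is) (there (there v∈)) = ∈-endpoint e is v∈

  endpoint-injective : ∀ (e : Fin c → V × V) {is} → Unique (flatten (map e is)) →
    ∀ {i j b b′} → i ∈ is → j ∈ is → endpoint e (i , b) ≡ endpoint e (j , b′) → (i , b) ≡ (j , b′)
  endpoint-injective e u {b = false} {false} (here refl) (here refl) eq = refl
  endpoint-injective e u {b = true} {true} (here refl) (here refl) eq = refl
  endpoint-injective e ((u≢v ∷ _) ∷ _) {b = false} {true} (here refl) (here refl) eq = contradiction eq u≢v
  endpoint-injective e ((u≢v ∷ _) ∷ _) {b = true} {false} (here refl) (here refl) eq = contradiction (≡.sym eq) u≢v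
  endpoint-injective e ((_ ∷ u∉) ∷ _) {b = false} {b′} (here refl) (there j∈) eq =
    contradiction eq (All.lookup u∉ (endpoint-∈ e b′ j∈))
  endpoint-injective e (_ ∷ v∉ ∷ _) {b = true} {b′} (here refl) (there j∈) eq =
    contradiction eq (All.lookup v∉ (endpoint-∈ e b′ j∈))
  endpoint-injective e ((_ ∷ u∉) ∷ _) {b = b} {false} (there i∈) (here refl) eq =
    contradiction (≡.sym eq) (All.lookup u∉ (endpoint-∈ e b i∈))
  endpoint-injective e (_ ∷ v∉ ∷ _) {b = b} {true} (there i∈) (here refl) eq =
    contradiction (≡.sym eq) (All.lookup v∉ (endpoint-∈ e b i∈))
  endpoint-injective e (_ ∷ _ ∷ u) (there i∈) (there j∈) eq = endpoint-injective e u i∈ j∈ eq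

  -- Surjectivity of the endpoint map puts every vertex in the flattened list, and both lists have
  -- 2c entries.
  edges-↭ : ∀ {adj} (M : PerfectMatching c adj) → flatten (map (edge M) (allFin c)) ↭ allFin (2 ℕ.* c)
  edges-↭ M with unique-⊆⇒↭ (allFin⁺ (2 ℕ.* c)) covered
    where
      covered : ∀ v → v ∈ allFin (2 ℕ.* c) → v ∈ flatten (map (edge M) (allFin c))
      covered v _ with (i , b) , eq ← proj₂ (cover M) v =
        subst (_∈ flatten (map (edge M) (allFin c))) (eq refl) (endpoint-∈ (edge M) b (∈-allFin i))
  ... | [] , p = ↭-trans p (↭-reflexive (++-identityʳ _))
  ... | z ∷ zs , p = contradiction lengths (ℕₚ.m≢1+m+n (2 ℕ.* c))
    where
      open ≡.≡-Reasoning
      lengths : 2 ℕ.* c ≡ suc (2 ℕ.* c ℕ.+ length zs)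
      lengths = begin
        2 ℕ.* c                                             ≡⟨ cong (2 ℕ.*_) (≡.trans (length-map (edge M) (allFin c)) (length-allFin c)) ⟨
        2 ℕ.* length (map (edge M) (allFin c))              ≡⟨ length-flatten (map (edge M) (allFin c)) ⟨
        length (flatten (map (edge M) (allFin c)))          ≡⟨ ↭-length p ⟩
        length (allFin (2 ℕ.* c) ++ z ∷ zs)                 ≡⟨ length-++ (allFin (2 ℕ.* c)) ⟩
        length (allFin (2 ℕ.* c)) ℕ.+ suc (length zs)       ≡⟨ cong (ℕ._+ suc (length zs)) (length-allFin (2 ℕ.* c)) ⟩
        2 ℕ.* c ℕ.+ suc (length zs)                         ≡⟨ ℕₚ.+-suc (2 ℕ.* c) (length zs) ⟩
        suc (2 ℕ.* c ℕ.+ length zs)                         ∎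

  -- `Adj ℓ` unfolds to this with `w = vweight ℓ`, so the results below apply to the graph of the
  -- algorithm directly.
  ThresholdAdj : (V → ℚ) → V → V → Set
  ThresholdAdj w u v = u ≢ v × (w u + w v ≤ 1ℚ)

  module _ {w : V → ℚ} where

    open Threshold w

    toMatching : (e : Fin c → V × V) → flatten (map e (allFin c)) ↭ allFin (2 ℕ.* c) →
                 (∀ i → pairWeight (e i) ≤ 1ℚ) → PerfectMatching c (ThresholdAdj w)
    toMatching e p fits .edge = e
    toMatching e p fits .isEdge i =
      (λ eq → contradiction (endpoint-injective e unique {i} {i} {false} {true} (∈-allFin i) (∈-allFin i) eq) λ ()) , fits i
      where unique = Unique-resp-↭ (↭-sym p) (allFin⁺ (2 ℕ.* c))
    toMatching e p fits .cover =
      endpoint-injective e (Unique-resp-↭ (↭-sym p) (allFin⁺ (2 ℕ.* c))) (∈-allFin _) (∈-allFin _) ,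
      λ v → let ib , eq = ∈-endpoint e (allFin c) (∈-resp-↭ (↭-sym p) (∈-allFin v)) in ib , λ { refl → eq }

    edgeWeights : ∀ {adj} → PerfectMatching c adj → List ℚ
    edgeWeights M = map (edgeWeight {c} w ∘ edge M) (allFin c)

    sortedWeights-↭ : ∀ {adj} (M : PerfectMatching c adj) → sortedWeights w M ↭ edgeWeights M
    sortedWeights-↭ M = ↭-trans (↭-reverse (sort (edgeWeights M))) (sort-↭ (edgeWeights M))

    sortedWeights-descending : ∀ {adj} (M : PerfectMatching c adj) → Descending (sortedWeights w M)
    sortedWeights-descending M = reverse-descending (Linked⇒AllPairs ℚₚ.≤-trans (sort-↗ (edgeWeights M)))

    length-sortedWeights : ∀ {adj} (M : PerfectMatching c adj) → length (sortedWeights w M) ≡ c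
    length-sortedWeights M = ≡.trans (↭-length (sortedWeights-↭ M))
      (≡.trans (length-map _ (allFin c)) (length-allFin c))

    excess-sortedWeights : ∀ {adj} (M : PerfectMatching c adj) t →
                           excess t (sortedWeights w M) ≡ excess t (edgeWeights M)
    excess-sortedWeights M t = ∑-↭ (λ p → pos (p - t)) (sortedWeights-↭ M)

    dominates⇒excess : ∀ {adj} (M N : PerfectMatching c adj) → Dominates w M N →
                       ∀ t → excess t (edgeWeights N) ≤ excess t (edgeWeights M)
    dominates⇒excess M N dom t = ≡.subst₂ _≤_ (excess-sortedWeights N t) (excess-sortedWeights M t)
      (sum-take-mono⇒excess-mono (sortedWeights-descending N)
        (≡.trans (length-sortedWeights N) (≡.sym (length-sortedWeights M)))
        (λ k 1≤k k≤ → dom k 1≤k (subst (k ℕ.≤_) (length-sortedWeights M) k≤)) t)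

    excess⇒dominates : ∀ {adj} (M N : PerfectMatching c adj) →
                       (∀ t → excess t (edgeWeights N) ≤ excess t (edgeWeights M)) → Dominates w M N
    excess⇒dominates M N le k 1≤k k≤c = excess-mono⇒sum-take-mono (sortedWeights-descending M)
      (≡.trans (length-sortedWeights N) (≡.sym (length-sortedWeights M)))
      (λ t → ≡.subst₂ _≤_ (≡.sym (excess-sortedWeights N t)) (≡.sym (excess-sortedWeights M t)) (le t))
      k 1≤k (subst (k ℕ.≤_) (≡.sym (length-sortedWeights M)) k≤c)

    pairExcess-edges : ∀ {adj} (M : PerfectMatching c adj) t →
                       pairExcess t (map (edge M) (allFin c)) ≡ excess t (edgeWeights M)
    pairExcess-edges M t = cong (excess t) (≡.sym (map-∘ (allFin c)))

    edges-fit : (M : PerfectMatching c (ThresholdAdj w)) → Fits (map (edge M) (allFin c))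
    edges-fit M = Allₚ.map⁺ (All.tabulate (λ {i} _ → proj₂ (isEdge M i)))

    dominant-exists : PerfectMatching c (ThresholdAdj w) →
                      Σ (PerfectMatching c (ThresholdAdj w)) (IsDominant w)
    dominant-exists M
      with es , es↭ , fits , opt ← optimal-exists _ (map (edge M) (allFin c)) refl (edges-fit M)
      -- Twice the number of edges is the number 2c of vertices, so the optimal list has c edges and
      -- can be indexed by `Fin c`.
      with e , refl ← as-image {c = c} es (ℕₚ.*-cancelˡ-≡ (length es) c 2
             (≡.trans (≡.sym (length-flatten es)) (≡.trans (↭-length (↭-trans es↭ (edges-↭ M))) (length-allFin (2 ℕ.* c))))) =
      D , λ N → excess⇒dominates D N λ t →
        ≡.subst₂ _≤_ (pairExcess-edges N t) (pairExcess-edges D t)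
          (opt (map (edge N) (allFin c)) (↭-trans (edges-↭ N) (↭-sym (edges-↭ M))) (edges-fit N) t)
      where
        D : PerfectMatching c (ThresholdAdj w)
        D = toMatching e (↭-trans es↭ (edges-↭ M)) (λ i → All.lookup (Allₚ.map⁻ fits) (∈-allFin i))

  -- Every vertex is covered exactly once, so the left side does not depend on the matching. This
  -- serves for loads and for cache demands.
  ∑-endpoints : ∀ {adj} (M : PerfectMatching c adj) (f : V → ℚ) →
                ∑ (allFin c) (λ i → edgeWeight {c} f (edge M i)) ≡ ∑ (allFin (2 ℕ.* c)) f
  ∑-endpoints M f = ≡.trans (≡.sym (∑-flatten-map (edge M) (allFin c) f)) (∑-↭ f (edges-↭ M))

  -- All perfect matchings have the same total weight, so dominance also bounds the lightest edges.
  dominant-slack : ∀ {adj} {w : V → ℚ} (M N : PerfectMatching c adj) → Dominates w M N → ∀ t →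
    ∑ (allFin c) (λ i → pos (t - edgeWeight {c} w (edge N i))) ≤
    ∑ (allFin c) (λ i → pos (t - edgeWeight {c} w (edge M i)))
  dominant-slack {adj} {w} M N dom t = begin
    slack N                                        ≡⟨ slack≡ N ⟩
    excess t (edgeWeights {w} N) + (∑ (allFin c) (const t) - ∑ (allFin (2 ℕ.* c)) w)
      ≤⟨ ℚₚ.+-monoˡ-≤ _ (dominates⇒excess {w} M N dom t) ⟩
    excess t (edgeWeights {w} M) + (∑ (allFin c) (const t) - ∑ (allFin (2 ℕ.* c)) w)
                                                   ≡⟨ slack≡ M ⟨
    slack M                                        ∎
    where
      slack : PerfectMatching c adj → ℚ
      slack M = ∑ (allFin c) (λ i → pos (t - edgeWeight {c} w (edge M i)))
      -- After `pos-flip`, the slack differs from the excess only by a term common to all perfect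
      -- matchings.
      slack≡ : ∀ M → slack M ≡ excess t (edgeWeights {w} M) + (∑ (allFin c) (const t) - ∑ (allFin (2 ℕ.* c)) w)
      slack≡ M = ≡.trans (∑-cong (allFin c) (λ i _ → pos-flip t (L i)))
        (≡.trans (∑-+ (allFin c) (λ i → pos (L i - t)) (λ i → t - L i))
          (cong₂ _+_ (≡.sym (∑-map L (allFin c) (λ p → pos (p - t))))
            (≡.trans (∑-- (allFin c) (const t) L) (cong (λ s → ∑ (allFin c) (const t) - s) (∑-endpoints M w)))))
        where L = λ i → edgeWeight {c} w (edge M i)
      open ≤-Reasoning

-- The matching of a given schedule

module _ (_≟_ : DecidableEquality B) (key : A → B) where

  fibre : List A → B → List A
  fibre xs k = filter (λ x → key x ≟ k) xs

  fibre-accept : ∀ x xs → fibre (x ∷ xs) (key x) ≡ x ∷ fibre xs (key x)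
  fibre-accept x xs = filter-accept (λ y → key y ≟ key x) refl

  fibre-reject : ∀ {k} x xs → key x ≢ k → fibre (x ∷ xs) k ≡ fibre xs k
  fibre-reject {k} x xs = filter-reject (λ y → key y ≟ k)

  fibres-reject : ∀ x xs ks → All (key x ≢_) ks →
                  concatMap (fibre (x ∷ xs)) ks ≡ concatMap (fibre xs) ks
  fibres-reject x xs [] [] = refl
  fibres-reject x xs (k ∷ ks) (ne ∷ nes) = cong₂ _++_ (fibre-reject x xs ne) (fibres-reject x xs ks nes)

  fibres-insert : ∀ x xs {ks} → Unique ks → key x ∈ ks →
                  concatMap (fibre (x ∷ xs)) ks ↭ x ∷ concatMap (fibre xs) ks
  fibres-insert x xs {k ∷ ks} (k∉ ∷ _) (here refl) =
    ↭-reflexive (cong₂ _++_ (fibre-accept x xs) (fibres-reject x xs ks k∉))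
  fibres-insert x xs {k ∷ ks} (k∉ ∷ u) (there k∈) = begin
    fibre (x ∷ xs) k ++ concatMap (fibre (x ∷ xs)) ks
      ≡⟨ cong (_++ _) (fibre-reject x xs (λ eq → All.lookup k∉ k∈ (≡.sym eq))) ⟩
    fibre xs k ++ concatMap (fibre (x ∷ xs)) ks         ↭⟨ ++⁺ˡ (fibre xs k) (fibres-insert x xs u k∈) ⟩
    fibre xs k ++ x ∷ concatMap (fibre xs) ks           ↭⟨ shift x (fibre xs k) _ ⟩
    x ∷ fibre xs k ++ concatMap (fibre xs) ks           ∎
    where open PermutationReasoning

  -- Serves to split jobs by their core in the schedule, and vertices by the core of their job, if
  -- they have one.
  fibres-↭ : ∀ {ks} → Unique ks → ∀ xs → (∀ x → x ∈ xs → key x ∈ ks) → xs ↭ concatMap (fibre xs) ks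
  fibres-↭ {ks} u [] _ = ↭-reflexive (≡.sym (empty ks))
    where
      empty : ∀ ks → concatMap (fibre []) ks ≡ []
      empty [] = refl
      empty (_ ∷ ks) = empty ks
  fibres-↭ u (x ∷ xs) k∈ = ↭-trans (↭-prep x (fibres-↭ u xs (λ y → k∈ y ∘ there)))
    (↭-sym (fibres-insert x xs u (k∈ x (here refl))))

∑-⊆ : ∀ {xs ys : List A} (f : A → ℚ) → (∀ x → 0ℚ ≤ f x) → Unique xs →
      (∀ x → x ∈ xs → x ∈ ys) → ∑ xs f ≤ ∑ ys f
∑-⊆ {xs = xs} {ys} f 0≤f u sub with zs , p ← unique-⊆⇒↭ u sub = begin
  ∑ xs f              ≤⟨ p≤p+q (∑-nonneg zs (λ z _ → 0≤f z)) ⟩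
  ∑ xs f + ∑ zs f     ≡⟨ ∑-++ xs zs f ⟨
  ∑ (xs ++ zs) f      ≡⟨ ∑-↭ f p ⟨
  ∑ ys f              ∎
  where open ≤-Reasoning

length-concatMap : ∀ (g : B → List A) {m} ks → (∀ k → length (g k) ℕ.≤ m) →
                   length (concatMap g ks) ℕ.≤ length ks ℕ.* m
length-concatMap g [] le = z≤n
length-concatMap g (k ∷ ks) le =
  subst (ℕ._≤ _) (≡.sym (length-++ (g k))) (ℕₚ.+-mono-≤ (le k) (length-concatMap g ks le))

concatMap-allFin : ∀ {c} (g : Fin c → List A) → concatMap g (allFin c) ≡ concat (tabulate g)
concatMap-allFin g = cong concat (map-tabulate id g)

-- Completes every group of at most two elements to a pair, drawing on the pool `U`. The first core
-- takes the first two elements of its group followed by the pool; what is left is the pool of the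
-- other cores.
pad : ∀ {c} (P : Fin c → List A) U → (∀ i → length (P i) ℕ.≤ 2) →
      length (concat (tabulate P) ++ U) ≡ c ℕ.* 2 →
      ∃ λ (e : Fin c → A × A) → flatten (tabulate e) ↭ concat (tabulate P) ++ U ×
        (∀ i v → v ∈ proj₁ (e i) ∷ proj₂ (e i) ∷ [] → v ∈ P i ⊎ v ∈ U)
pad {c = zero} P [] le len = (λ ()) , ↭-refl , λ ()
pad {A = A} {c = suc c} P U le len = build (P Fin.zero ++ U) refl
  where
    R : List A
    R = concat (tabulate (P ∘ Fin.suc))

    rearrange : (P Fin.zero ++ R) ++ U ↭ R ++ (P Fin.zero ++ U)
    rearrange = ↭-trans (↭-reflexive (++-assoc (P Fin.zero) R U)) (shifts (P Fin.zero) R)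

    length-R : length R ℕ.≤ c ℕ.* 2
    length-R = ≡.subst₂ (λ xs n → length xs ℕ.≤ n ℕ.* 2) (concatMap-allFin (P ∘ Fin.suc)) (length-allFin c)
      (length-concatMap (P ∘ Fin.suc) (allFin c) (le ∘ Fin.suc))

    length-split : length R ℕ.+ length (P Fin.zero ++ U) ≡ 2 ℕ.+ c ℕ.* 2
    length-split = ≡.trans (≡.sym (length-++ R)) (≡.trans (≡.sym (↭-length rearrange)) len)

    -- A group has at most two elements, so the pair uses all of it and the remainder `W` comes from
    -- the pool.
    suffix : ∀ (ps : List A) {u v W} → length ps ℕ.≤ 2 → ps ++ U ≡ u ∷ v ∷ W → ∀ {x} → x ∈ W → x ∈ U
    suffix [] _ refl x∈ = there (there x∈)
    suffix (_ ∷ []) _ refl x∈ = there x∈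
    suffix (_ ∷ _ ∷ []) _ refl x∈ = x∈
    suffix (_ ∷ _ ∷ _ ∷ _) (s≤s (s≤s ())) _ _

    build : ∀ X → P Fin.zero ++ U ≡ X →
      ∃ λ (e : Fin (suc c) → A × A) → flatten (tabulate e) ↭ (P Fin.zero ++ R) ++ U ×
        (∀ i v → v ∈ proj₁ (e i) ∷ proj₂ (e i) ∷ [] → v ∈ P i ⊎ v ∈ U)
    -- With fewer than two elements available here, the remaining c groups would hold more than 2c
    -- elements.
    build [] eq = contradiction
      (ℕₚ.≤-trans (ℕₚ.≤-reflexive (≡.sym (≡.trans (≡.sym (ℕₚ.+-identityʳ _)) (subst (λ X → length R ℕ.+ length X ≡ _) eq length-split)))) length-R)
      (ℕₚ.<⇒≱ (s≤s (ℕₚ.n≤1+n _)))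
    build (x ∷ []) eq = contradiction
      (ℕₚ.≤-trans (ℕₚ.≤-reflexive (ℕₚ.suc-injective (≡.sym (≡.trans (≡.sym (ℕₚ.+-comm _ 1)) (subst (λ X → length R ℕ.+ length X ≡ _) eq length-split))))) length-R)
      (ℕₚ.<⇒≱ ℕₚ.≤-refl)
    build (u ∷ v ∷ W) eq =
      let e , p , mem = pad (P ∘ Fin.suc) W (le ∘ Fin.suc) length-W in
      (λ { Fin.zero → u , v ; (Fin.suc i) → e i }) ,
      ↭-trans (↭-prep u (↭-prep v p)) (↭-sym (begin
        (P Fin.zero ++ R) ++ U   ↭⟨ rearrange ⟩
        R ++ P Fin.zero ++ U     ≡⟨ cong (R ++_) eq ⟩
        R ++ u ∷ v ∷ W           ↭⟨ shift u R (v ∷ W) ⟩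
        u ∷ R ++ v ∷ W           ↭⟨ ↭-prep u (shift v R W) ⟩
        u ∷ v ∷ R ++ W           ∎)) ,
      λ { Fin.zero x (here refl) → ∈-++⁻ (P Fin.zero) (subst (u ∈_) (≡.sym eq) (here refl))
        ; Fin.zero x (there (here refl)) → ∈-++⁻ (P Fin.zero) (subst (v ∈_) (≡.sym eq) (there (here refl)))
        ; (Fin.suc i) x x∈ → Sum.map₂ (suffix (P Fin.zero) (le Fin.zero) eq) (mem i x x∈) }
      where
        open PermutationReasoning
        length-W : length (R ++ W) ≡ c ℕ.* 2
        length-W = ℕₚ.suc-injective (ℕₚ.suc-injective (≡.trans
          (cong (suc ∘ suc) (length-++ R {W}))
          (≡.trans (≡.trans (cong suc (≡.sym (ℕₚ.+-suc (length R) (length W)))) (≡.sym (ℕₚ.+-suc (length R) (suc (length W)))))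
            (subst (λ X → length R ℕ.+ length X ≡ _) eq length-split))))

-- Large and small jobs in the given schedule

-- Used on the list of large jobs as the vertex labelling: positions past its end are the artificial
-- vertices.
nth : List A → ℕ → Maybe A
nth [] _ = nothing
nth (x ∷ xs) zero = just x
nth (x ∷ xs) (suc k) = nth xs k

nth-∈ : ∀ (xs : List A) k {x} → nth xs k ≡ just x → x ∈ xs
nth-∈ (x ∷ xs) zero refl = here refl
nth-∈ (x ∷ xs) (suc k) eq = there (nth-∈ xs k eq)

∈-nth : ∀ {xs : List A} {x} → x ∈ xs → ∃ λ k → k ℕ.< length xs × nth xs k ≡ just x
∈-nth (here refl) = 0 , s≤s z≤n , refl
∈-nth (there x∈) = let k , k< , eq = ∈-nth x∈ in suc k , s≤s k< , eq

nth-injective : ∀ {xs : List A} → Unique xs → ∀ k l {x} → nth xs k ≡ just x → nth xs l ≡ just x → k ≡ l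
nth-injective {xs = _ ∷ _} u zero zero _ _ = refl
nth-injective {xs = _ ∷ xs} (x∉ ∷ _) zero (suc l) refl eq = contradiction refl (All.lookup x∉ (nth-∈ xs l eq))
nth-injective {xs = _ ∷ xs} (x∉ ∷ _) (suc k) zero eq refl = contradiction refl (All.lookup x∉ (nth-∈ xs k eq))
nth-injective {xs = _ ∷ _} (_ ∷ u) (suc k) (suc l) eq eq′ = cong suc (nth-injective u k l eq eq′)

module Schedule {n c : ℕ} {a : Fin n → ℚ} (0<a : ∀ j → 0ℚ < a j)
                (S : Fin n → Fin c) (makespan : ∀ i → coreLoad a S i ≤ 1ℚ) where

  core-load≤1 : ∀ {i js} → Unique js → (∀ j → j ∈ js → S j ≡ i) → ∑ js a ≤ 1ℚ
  core-load≤1 {i} u on = ℚₚ.≤-trans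
    (∑-⊆ a (λ j → ℚₚ.<⇒≤ (0<a j)) u (λ j j∈ → ∈-filter⁺ (λ j → S j Fin.≟ i) (∈-allFin j) (on j j∈)))
    (makespan i)

  -- Three jobs of load above 1/3 would exceed the makespan 1.
  large-per-core : ∀ {i js} → Unique js → (∀ j → j ∈ js → S j ≡ i) → (∀ j → j ∈ js → Large a j) →
                   length js ℕ.≤ 2
  large-per-core {js = []} _ _ _ = z≤n
  large-per-core {js = _ ∷ []} _ _ _ = s≤s z≤n
  large-per-core {js = _ ∷ _ ∷ []} _ _ _ = s≤s (s≤s z≤n)
  large-per-core {js = j ∷ k ∷ l ∷ js} u on large = contradiction (core-load≤1 u on) (<⇒≱ (begin-strict
    third + (third + (third + 0ℚ))  <⟨ ℚₚ.+-mono-< (large j (here refl)) (ℚₚ.+-mono-< (large k (there (here refl)))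
                                         (ℚₚ.+-mono-<-≤ (large l (there (there (here refl)))) (∑-nonneg js (λ j _ → ℚₚ.<⇒≤ (0<a j))))) ⟩
    ∑ (j ∷ k ∷ l ∷ js) a            ∎))
    where open ≤-Reasoning

  private
    larges : List (Fin n)
    larges = filter (λ j → third ℚₚ.<? a j) (allFin n)

    larges-unique : Unique larges
    larges-unique = Uniqueₚ.filter⁺ (λ j → third ℚₚ.<? a j) (allFin⁺ n)

    length-larges : length larges ℕ.≤ 2 ℕ.* c
    length-larges = begin
      length larges                                               ≡⟨ ↭-length (fibres-↭ Fin._≟_ S (allFin⁺ c) larges (λ j _ → ∈-allFin (S j))) ⟩
      length (concatMap (fibre Fin._≟_ S larges) (allFin c))     ≤⟨ length-concatMap (fibre Fin._≟_ S larges) (allFin c) (λ i → large-per-core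
                                                                       (Uniqueₚ.filter⁺ (λ j → S j Fin.≟ i) larges-unique)
                                                                       (λ j j∈ → proj₂ (∈-filter⁻ (λ j → S j Fin.≟ i) {xs = larges} j∈))
                                                                       (λ j j∈ → proj₂ (∈-filter⁻ (λ j → third ℚₚ.<? a j) {xs = allFin n} (proj₁ (∈-filter⁻ (λ j → S j Fin.≟ i) {xs = larges} j∈))))) ⟩
      length (allFin c) ℕ.* 2                                     ≡⟨ cong (ℕ._* 2) (length-allFin c) ⟩
      c ℕ.* 2                                                     ≡⟨ ℕₚ.*-comm c 2 ⟩
      2 ℕ.* c                                                     ∎
      where open ℕₚ.≤-Reasoning

  labelling : VertexLabelling n c a
  labelling .label u = nth larges (toℕ u)
  labelling .label-inj u v j eq eq′ = Finₚ.toℕ-injective (nth-injective larges-unique (toℕ u) (toℕ v) eq eq′)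
  labelling .label-large u j eq = proj₂ (∈-filter⁻ (λ j → third ℚₚ.<? a j) {xs = allFin n} (nth-∈ larges (toℕ u) eq))
  labelling .label-onto j large =
    let k , k< , eq = ∈-nth (∈-filter⁺ (λ j → third ℚₚ.<? a j) (∈-allFin j) large)
        k<2c = ℕₚ.≤-trans k< length-larges
    in fromℕ< k<2c , ≡.trans (cong (nth larges) (Finₚ.toℕ-fromℕ< k<2c)) eq

  module _ (ℓ : VertexLabelling n c a) where

    private
      V : Set
      V = Fin (2 ℕ.* c)

    jobs : List V → List (Fin n)
    jobs = mapMaybe (label ℓ)

    ∈-jobs⁻ : ∀ {j} vs → j ∈ jobs vs → ∃ λ v → v ∈ vs × label ℓ v ≡ just j
    ∈-jobs⁻ (v ∷ vs) j∈ with label ℓ v in eq | j∈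
    ... | nothing | j∈′ = let u , u∈ , eq′ = ∈-jobs⁻ vs j∈′ in u , there u∈ , eq′
    ... | just _ | here refl = v , here refl , eq
    ... | just _ | there j∈′ = let u , u∈ , eq′ = ∈-jobs⁻ vs j∈′ in u , there u∈ , eq′

    jobs-unique : ∀ {vs} → Unique vs → Unique (jobs vs)
    jobs-unique [] = []
    jobs-unique {v ∷ vs} (v∉ ∷ u) with label ℓ v in eq
    ... | nothing = jobs-unique u
    ... | just j = All.tabulate (λ {k} k∈ j≡k → let w , w∈ , eq′ = ∈-jobs⁻ vs k∈ in
            All.lookup v∉ w∈ (label-inj ℓ v w j eq (≡.trans eq′ (cong just (≡.sym j≡k))))) ∷ jobs-unique u

    ∑-jobs : ∀ vs f → ∑ (jobs vs) f ≡ ∑ vs (atVertex ℓ f)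
    ∑-jobs [] f = refl
    ∑-jobs (v ∷ vs) f with label ℓ v
    ... | nothing = ≡.trans (∑-jobs vs f) (≡.sym (ℚₚ.+-identityˡ _))
    ... | just j = cong (f j +_) (∑-jobs vs f)

    private
      -- The value `nothing` marks the artificial vertices, which form the pool for `pad`.
      coreOf : V → Maybe (Fin c)
      coreOf v = Maybe.map S (label ℓ v)

      _≟_ : DecidableEquality (Maybe (Fin c))
      _≟_ = Maybeₚ.≡-dec Fin._≟_

      group : Maybe (Fin c) → List V
      group = fibre _≟_ coreOf (allFin (2 ℕ.* c))

      group-core : ∀ {k v} → v ∈ group k → coreOf v ≡ k
      group-core {k} v∈ = proj₂ (∈-filter⁻ (λ v → coreOf v ≟ k) {xs = allFin (2 ℕ.* c)} v∈)

      length-labelled : ∀ vs → (∀ v → v ∈ vs → coreOf v ≢ nothing) → length vs ≡ length (jobs vs)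
      length-labelled [] _ = refl
      length-labelled (v ∷ vs) lab with label ℓ v in eq
      ... | nothing = contradiction (cong (Maybe.map S) eq) (lab v (here refl))
      ... | just j = cong suc (length-labelled vs (λ u → lab u ∘ there))

      on-core : ∀ {i v j} → coreOf v ≡ just i ⊎ coreOf v ≡ nothing → label ℓ v ≡ just j → S j ≡ i
      on-core (inj₁ eq′) eq = Maybeₚ.just-injective (≡.trans (≡.sym (cong (Maybe.map S) eq)) eq′)
      on-core (inj₂ eq′) eq = contradiction (≡.trans (≡.sym (cong (Maybe.map S) eq)) eq′) λ ()

      length-group : ∀ i → length (group (just i)) ℕ.≤ 2
      length-group i = subst (ℕ._≤ 2)
        (≡.sym (length-labelled (group (just i)) (λ v v∈ eq → contradiction (≡.trans (≡.sym (group-core v∈)) eq) λ ())))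
        (large-per-core {i} (jobs-unique (Uniqueₚ.filter⁺ (λ v → coreOf v ≟ just i) (allFin⁺ (2 ℕ.* c))))
          (λ j j∈ → let v , v∈ , eq = ∈-jobs⁻ (group (just i)) j∈ in on-core (inj₁ (group-core v∈)) eq)
          (λ j j∈ → let v , _ , eq = ∈-jobs⁻ (group (just i)) j∈ in label-large ℓ v j eq))

      groups-↭ : allFin (2 ℕ.* c) ↭ concat (tabulate (group ∘ just)) ++ group nothing
      groups-↭ = begin
        allFin (2 ℕ.* c)
          ↭⟨ fibres-↭ _≟_ coreOf keys-unique (allFin (2 ℕ.* c)) (λ v _ → all-keys (coreOf v)) ⟩
        group nothing ++ concat (map group (map just (allFin c)))
          ≡⟨ cong (λ xs → group nothing ++ concat xs) (≡.sym (map-∘ (allFin c))) ⟩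
        group nothing ++ concatMap (group ∘ just) (allFin c)
          ≡⟨ cong (group nothing ++_) (concatMap-allFin (group ∘ just)) ⟩
        group nothing ++ concat (tabulate (group ∘ just))
          ↭⟨ ++-comm (group nothing) _ ⟩
        concat (tabulate (group ∘ just)) ++ group nothing  ∎
        where
          open PermutationReasoning
          keys-unique : Unique (nothing ∷ map just (allFin c))
          keys-unique = Allₚ.map⁺ (All.tabulate (λ _ ())) ∷ Uniqueₚ.map⁺ Maybeₚ.just-injective (allFin⁺ c)
          all-keys : ∀ k → k ∈ nothing ∷ map just (allFin c)
          all-keys nothing = here refl
          all-keys (just i) = there (∈-map⁺ just (∈-allFin i))

    ends : PerfectMatching c (Adj ℓ) → Fin c → List V
    ends M i = proj₁ (edge M i) ∷ proj₂ (edge M i) ∷ []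

    ∑-jobs-ends : ∀ M i f → ∑ (jobs (ends M i)) f ≡ edgeWeight {c} (atVertex ℓ f) (edge M i)
    ∑-jobs-ends M i f = ≡.trans (∑-jobs (ends M i) f)
      (cong (atVertex ℓ f (proj₁ (edge M i)) +_) (ℚₚ.+-identityʳ _))

    -- Since the matching covers all vertices, edge i then carries exactly the large jobs that the
    -- schedule runs on core i.
    Respects : PerfectMatching c (Adj ℓ) → Set
    Respects M = ∀ {i v j} → v ∈ ends M i → label ℓ v ≡ just j → S j ≡ i

    -- The labelled vertices of a core number at most two and are padded to a pair by artificial
    -- ones. The makespan bound makes each pair an edge.
    schedule-matching : Σ (PerfectMatching c (Adj ℓ)) Respects
    schedule-matching with e , p , mem ← pad (group ∘ just) (group nothing) length-group
          (≡.trans (≡.sym (↭-length groups-↭)) (≡.trans (length-allFin (2 ℕ.* c)) (ℕₚ.*-comm 2 c))) =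
      toMatching {w = vweight ℓ} e e-↭ fits , onCore
      where
        e-↭ : flatten (map e (allFin c)) ↭ allFin (2 ℕ.* c)
        e-↭ = ↭-trans (↭-reflexive (cong flatten (map-tabulate id e))) (↭-trans p (↭-sym groups-↭))
        onCore : ∀ {i v j} → v ∈ proj₁ (e i) ∷ proj₂ (e i) ∷ [] → label ℓ v ≡ just j → S j ≡ i
        onCore {i} v∈ = on-core (Sum.map group-core group-core (mem i _ v∈))
        distinct : ∀ i → proj₁ (e i) ≢ proj₂ (e i)
        distinct i eq = contradiction
          (endpoint-injective e (Unique-resp-↭ (↭-sym e-↭) (allFin⁺ (2 ℕ.* c))) {i} {i} {false} {true} (∈-allFin i) (∈-allFin i) eq) λ ()
        fits : ∀ i → vweight ℓ (proj₁ (e i)) + vweight ℓ (proj₂ (e i)) ≤ 1ℚ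
        fits i = begin
          vweight ℓ (proj₁ (e i)) + vweight ℓ (proj₂ (e i))
            ≡⟨ cong (vweight ℓ (proj₁ (e i)) +_) (ℚₚ.+-identityʳ _) ⟨
          ∑ vs (vweight ℓ)  ≡⟨ ∑-jobs vs a ⟨
          ∑ (jobs vs) a     ≤⟨ core-load≤1 (jobs-unique ((distinct i ∷ []) ∷ [] ∷ []))
                                 (λ j j∈ → let v , v∈ , eq = ∈-jobs⁻ vs j∈ in onCore v∈ eq) ⟩
          1ℚ                ∎
          where
            open ≤-Reasoning
            vs = proj₁ (e i) ∷ proj₂ (e i) ∷ []

    module _ {M : PerfectMatching c (Adj ℓ)} (resp : Respects M)
             {js : List (Fin n)} (js-unique : Unique js) (js-small : ∀ j → j ∈ js → Small a j) where

      -- The large jobs of edge i and the small jobs of core i are disjoint and share core i, so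
      -- their total load is at most 1.
      small-load : ∀ i → ∑ (fibre Fin._≟_ S js i) a ≤ 1ℚ - largeLoad ℓ M i
      small-load i = shift-≤ total
        (≡.trans (cong (1ℚ - largeLoad ℓ M i +_) split)
          (solve 2 (λ l s → (con 1ℚ :- l) :+ (l :+ s) := s :+ con 1ℚ) refl (largeLoad ℓ M i) (∑ smalls a)))
        where
          smalls larges′ : List (Fin n)
          smalls = fibre Fin._≟_ S js i
          larges′ = jobs (ends M i)
          smalls⁻ : ∀ {j} → j ∈ smalls → j ∈ js × S j ≡ i
          smalls⁻ = ∈-filter⁻ (λ j → S j Fin.≟ i) {xs = js}
          split : ∑ (larges′ ++ smalls) a ≡ largeLoad ℓ M i + ∑ smalls a
          split = ≡.trans (∑-++ larges′ smalls a) (cong (_+ ∑ smalls a) (∑-jobs-ends M i a))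
          disjoint : ∀ {j} → ¬ (j ∈ larges′ × j ∈ smalls)
          disjoint {j} (j∈ , j∈′) = let v , _ , eq = ∈-jobs⁻ (ends M i) j∈ in
            <⇒≱ (label-large ℓ v j eq) (js-small j (proj₁ (smalls⁻ j∈′)))
          total : ∑ (larges′ ++ smalls) a ≤ 1ℚ
          total = core-load≤1 {i}
            (Uniqueₚ.++⁺ (jobs-unique ((proj₁ (isEdge M i) ∷ []) ∷ [] ∷ [])) (Uniqueₚ.filter⁺ (λ j → S j Fin.≟ i) js-unique) disjoint)
            (λ j j∈ → Sum.[ (λ j∈ → let v , v∈ , eq = ∈-jobs⁻ (ends M i) j∈ in resp v∈ eq) , proj₂ ∘ smalls⁻ ] (∈-++⁻ larges′ j∈))

      -- Used twice: with all cores, to show that the small jobs fit, and with the cores already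
      -- charged, in the cache bound.
      small-load-total : ∀ {cs} → Unique cs → (∀ j → j ∈ js → S j ∈ cs) →
                         ∑ js a ≤ ∑ cs (λ i → 1ℚ - largeLoad ℓ M i)
      small-load-total {cs} u S∈ = begin
        ∑ js a                                        ≡⟨ ∑-↭ a (fibres-↭ Fin._≟_ S u js S∈) ⟩
        ∑ (concatMap (fibre Fin._≟_ S js) cs) a       ≡⟨ ∑-concatMap (fibre Fin._≟_ S js) cs a ⟩
        ∑ cs (λ i → ∑ (fibre Fin._≟_ S js i) a)       ≤⟨ ∑-mono cs (λ i _ → small-load i) ⟩
        ∑ cs (λ i → 1ℚ - largeLoad ℓ M i)             ∎
        where open ≤-Reasoning

-- The greedy placement

AllPairs-++ˡ : ∀ {R : A → A → Set} xs {ys} → AllPairs R (xs ++ ys) → AllPairs R xs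
AllPairs-++ˡ [] _ = []
AllPairs-++ˡ (x ∷ xs) (r ∷ rs) = All.tabulate (λ z∈ → All.lookup r (∈-++⁺ˡ z∈)) ∷ AllPairs-++ˡ xs rs

AllPairs-cross : ∀ {R : A → A → Set} xs {z ys} → AllPairs R (xs ++ z ∷ ys) → ∀ {x} → x ∈ xs → R x z
AllPairs-cross (_ ∷ xs) (r ∷ _) (here refl) = All.lookup r (∈-++⁺ʳ xs (here refl))
AllPairs-cross (_ ∷ xs) (_ ∷ rs) (there x∈) = AllPairs-cross xs rs x∈

AllPairs-++ʳ : ∀ {R : A → A → Set} xs {ys} → AllPairs R (xs ++ ys) → AllPairs R ys
AllPairs-++ʳ [] rs = rs
AllPairs-++ʳ (_ ∷ xs) (_ ∷ rs) = AllPairs-++ʳ xs rs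

module Packings {n c : ℕ} (a : Fin n → ℚ) (L : Fin c → ℚ) where

  -- The first index is the small load already placed on the first core of the list.
  data Packing : ℚ → List (Fin c) → List (Fin n) → List (Fin n × Fin c) → Set where
    done : ∀ {acc} → Packing acc [] [] []
    -- The trailing `++ []` gives the result the same shape as for `full`, so that the lemmas on
    -- `smallOn` cover both.
    last : ∀ {acc k ks} js → L k + (acc + ∑ js a) ≤ 1ℚ →
           Packing acc (k ∷ ks) js (map (_, k) js ++ [])
    full : ∀ {acc k ks js res} block →
           1ℚ < L k + (acc + ∑ block a) → L k + (acc + ∑ block a) ≤ fourThirds →
           Packing 0ℚ ks js res →
           Packing acc (k ∷ ks) (block ++ js) (map (_, k) block ++ res)

  private
    reassoc : ∀ k acc j js → L k + (acc + a j + ∑ js a) ≡ L k + (acc + ∑ (j ∷ js) a)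
    reassoc k acc j js = cong (L k +_) (ℚₚ.+-assoc acc (a j) (∑ js a))

  -- The load invariant for a core just opened; `take 1` makes it vacuous when no core remains.
  fresh : (∀ k → L k ≤ 1ℚ) → ∀ ks → All (λ k → L k + 0ℚ ≤ 1ℚ) (take 1 ks)
  fresh L≤1 [] = []
  fresh L≤1 (k ∷ _) = subst (_≤ 1ℚ) (≡.sym (ℚₚ.+-identityʳ (L k))) (L≤1 k) ∷ []

  private
    remaining : ∀ k acc j js ks → acc + ∑ (j ∷ js) a ≤ ∑ (k ∷ ks) (λ k → 1ℚ - L k) → 1ℚ < L k + acc + a j →
                0ℚ + ∑ js a ≤ ∑ ks (λ k → 1ℚ - L k)
    remaining k acc j js ks cap over = shift-≤ (ℚₚ.+-mono-≤ cap (ℚₚ.<⇒≤ over))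
      (solve 5 (λ l acc j s t → t :+ ((acc :+ (j :+ s)) :+ con 1ℚ) := (con 0ℚ :+ s) :+ (((con 1ℚ :- l) :+ t) :+ ((l :+ acc) :+ j)))
        refl (L k) acc (a j) (∑ js a) (∑ ks (λ k → 1ℚ - L k)))

  greedy-over : ∀ {k ks acc j js} → 1ℚ < L k + acc + a j →
                greedy a L (k ∷ ks) acc (j ∷ js) ≡ Maybe.map ((j , k) ∷_) (greedy a L ks 0ℚ js)
  greedy-over {k} {acc = acc} {j} over with 1ℚ ℚₚ.<? (L k + acc + a j)
  ... | yes _ = refl
  ... | no ¬over = contradiction over ¬over

  greedy-under : ∀ {k ks acc j js} → ¬ (1ℚ < L k + acc + a j) →
                 greedy a L (k ∷ ks) acc (j ∷ js) ≡ Maybe.map ((j , k) ∷_) (greedy a L (k ∷ ks) (acc + a j) js)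
  greedy-under {k} {acc = acc} {j} ¬over with 1ℚ ℚₚ.<? (L k + acc + a j)
  ... | yes over = contradiction over ¬over
  ... | no _ = refl

  place : ∀ {acc k ks j js res} → Packing (acc + a j) (k ∷ ks) js res →
          Packing acc (k ∷ ks) (j ∷ js) ((j , k) ∷ res)
  place {acc} {k} {j = j} (last js le) = last (j ∷ js) (subst (_≤ 1ℚ) (reassoc k acc j js) le)
  place {acc} {k} {j = j} (full block lt le p) = full (j ∷ block)
    (subst (1ℚ <_) (reassoc k acc j block) lt) (subst (_≤ fourThirds) (reassoc k acc j block) le) p

  -- Two invariants: the current core has load at most 1, so one more small job brings it to at most
  -- 4/3, and the jobs left fit in the room left.
  greedy-packs : (∀ k → L k ≤ 1ℚ) → (∀ j → 0ℚ < a j) →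
    ∀ ks acc js → 0ℚ ≤ acc → All (λ k → L k + acc ≤ 1ℚ) (take 1 ks) →
    (∀ j → j ∈ js → Small a j) →
    acc + ∑ js a ≤ ∑ ks (λ k → 1ℚ - L k) →
    ∃ λ res → greedy a L ks acc js ≡ just res × Packing acc ks js res
  greedy-packs L≤1 0<a [] acc [] _ _ _ _ = [] , refl , done
  greedy-packs L≤1 0<a (k ∷ ks) acc [] _ (fits ∷ _) _ _ = [] , refl ,
    last [] (subst (λ s → L k + s ≤ 1ℚ) (≡.sym (ℚₚ.+-identityʳ acc)) fits)
  -- Without cores there is no room, yet `j` has positive load: the greedy placement never runs out
  -- of cores.
  greedy-packs L≤1 0<a [] acc (j ∷ js) 0≤acc _ _ cap =
    contradiction cap (<⇒≱ (ℚₚ.+-mono-≤-< 0≤acc (ℚₚ.+-mono-<-≤ (0<a j) (∑-nonneg js (λ i _ → ℚₚ.<⇒≤ (0<a i))))))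
  greedy-packs L≤1 0<a (k ∷ ks) acc (j ∷ js) 0≤acc (fits ∷ _) small cap = choose (1ℚ ℚₚ.<? (L k + acc + a j))
    where
      load≡ : L k + acc + a j ≡ L k + (acc + (a j + 0ℚ))
      load≡ = ≡.trans (ℚₚ.+-assoc (L k) acc (a j)) (cong (λ s → L k + (acc + s)) (≡.sym (ℚₚ.+-identityʳ (a j))))
      load≤ : L k + acc + a j ≤ fourThirds
      load≤ = ℚₚ.+-mono-≤ fits (small j (here refl))
      choose : Dec (1ℚ < L k + acc + a j) →
               ∃ λ res → greedy a L (k ∷ ks) acc (j ∷ js) ≡ just res × Packing acc (k ∷ ks) (j ∷ js) res
      choose (yes over) =
        let res , eq , p = greedy-packs L≤1 0<a ks 0ℚ js ℚₚ.≤-refl (fresh L≤1 ks) (λ i → small i ∘ there)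
                             (remaining k acc j js ks cap over)
        in (j , k) ∷ res , ≡.trans (greedy-over over) (cong (Maybe.map ((j , k) ∷_)) eq) ,
           full (j ∷ []) (subst (1ℚ <_) load≡ over) (subst (_≤ fourThirds) load≡ load≤) p
      choose (no ¬over) =
        let res , eq , p = greedy-packs L≤1 0<a (k ∷ ks) (acc + a j) js
                             (0≤p+q 0≤acc (ℚₚ.<⇒≤ (0<a j)))
                             (subst (_≤ 1ℚ) (ℚₚ.+-assoc (L k) acc (a j)) (ℚₚ.≮⇒≥ ¬over) ∷ [])
                             (λ i → small i ∘ there)
                             (subst (_≤ ∑ (k ∷ ks) (λ k → 1ℚ - L k)) (≡.sym (ℚₚ.+-assoc acc (a j) (∑ js a))) cap)
        in (j , k) ∷ res , ≡.trans (greedy-under ¬over) (cong (Maybe.map ((j , k) ∷_)) eq) , place p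

  smallOn-here : ∀ k block res → smallOn {n} {c} (map (_, k) block ++ res) k ≡ block ++ smallOn res k
  smallOn-here k [] res = refl
  smallOn-here k (j ∷ block) res =
    ≡.trans (cong (map proj₁) (filter-accept (λ p → proj₂ p Fin.≟ k) refl)) (cong (j ∷_) (smallOn-here k block res))

  smallOn-there : ∀ {k i} → k ≢ i → ∀ block res → smallOn {n} {c} (map (_, k) block ++ res) i ≡ smallOn res i
  smallOn-there k≢i [] res = refl
  smallOn-there {k} {i} k≢i (j ∷ block) res =
    ≡.trans (cong (map proj₁) (filter-reject (λ p → proj₂ p Fin.≟ i) k≢i)) (smallOn-there k≢i block res)

  smallOn-∉ : ∀ {acc ks js res i} → Packing acc ks js res → i ∉ ks → smallOn res i ≡ []
  smallOn-∉ done _ = refl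
  smallOn-∉ {res = res} (last js _) i∉ = smallOn-there (λ { refl → i∉ (here refl) }) js []
  smallOn-∉ (full {res = res} block _ _ p) i∉ =
    ≡.trans (smallOn-there (λ { refl → i∉ (here refl) }) block res) (smallOn-∉ p (i∉ ∘ there))

  packing-load : (∀ k → L k ≤ fourThirds) → ∀ {ks js res} → Unique ks → Packing 0ℚ ks js res →
                 ∀ i → L i + ∑ (smallOn res i) a ≤ fourThirds
  packing-load L≤ u done i = subst (_≤ fourThirds) (≡.sym (ℚₚ.+-identityʳ (L i))) (L≤ i)
  packing-load L≤ u (last {k = k} js le) i with k Fin.≟ i
  ... | yes refl rewrite smallOn-here k js [] | ∑-++ js [] a | ℚₚ.+-identityʳ (∑ js a) | ℚₚ.+-identityˡ (∑ js a) =
    ℚₚ.≤-trans le (ℚₚ.≤ᵇ⇒≤ _)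
  ... | no k≢i rewrite smallOn-there k≢i js [] | ℚₚ.+-identityʳ (L i) = L≤ i
  packing-load L≤ (k∉ ∷ u) (full {k = k} {res = res} block lt le p) i with k Fin.≟ i
  ... | yes refl rewrite smallOn-here k block res | smallOn-∉ p (λ k∈ → All.lookup k∉ k∈ refl)
                       | ∑-++ block [] a | ℚₚ.+-identityʳ (∑ block a) | ℚₚ.+-identityˡ (∑ block a) = le
  ... | no k≢i rewrite smallOn-there k≢i block res = packing-load L≤ u p i

  -- Charging the cache of the small jobs

  module Cache (x : Fin n → ℚ) (L≤1 : ∀ k → L k ≤ 1ℚ)
               (p : Fin c → ℚ) (0≤p : ∀ i → 0ℚ ≤ p i)
               (ks₀ : List (Fin c)) (js₀ : List (Fin n)) where

    smallCache : List (Fin n × Fin c) → Fin c → ℚ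
    smallCache res i = maxℚ (map x (smallOn res i))

    -- The situation when `f` is the first small job put on `k`: the cores `pre` have been filled to
    -- at least 1 by the jobs `before`, and as many cores `taken` of the schedule have been charged.
    -- Some core not yet charged must have enough cache for `f`.
    Available : Set
    Available = ∀ {k f} pre ks before js taken left →
      ks₀ ≡ pre ++ k ∷ ks → js₀ ≡ before ++ f ∷ js →
      ∑ pre (λ i → 1ℚ - L i) ≤ ∑ before a →
      allFin c ↭ taken ++ left → length taken ≡ length pre →
      Any (λ i → x f ≤ p i) left

    max-bound : ∀ {q} js → 0ℚ ≤ q → All (λ j → x j ≤ q) js → maxℚ (map x js) ≤ q
    max-bound [] 0≤q [] = 0≤q
    max-bound (j ∷ js) 0≤q (le ∷ les) = ℚₚ.⊔-lub le (max-bound js 0≤q les)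

    private
      idle : ∀ {res} ks → (∀ i → i ∈ ks → smallOn res i ≡ []) → ∑ ks (smallCache res) ≡ 0ℚ
      idle [] _ = refl
      idle {res} (k ∷ ks) none = cong₂ _+_ (cong (maxℚ ∘ map x) (none k (here refl))) (idle {res} ks (λ i → none i ∘ there))

    -- Each core's first small job has the largest demand of its block; it is charged to a core of
    -- the given schedule not charged before.
    packing-cache : Available → ∀ {ks js res} → Packing 0ℚ ks js res → Unique ks →
      AllPairs (λ j j′ → x j′ ≤ x j) js →
      ∀ pre before taken left → ks₀ ≡ pre ++ ks → js₀ ≡ before ++ js →
      ∑ pre (λ i → 1ℚ - L i) ≤ ∑ before a →
      allFin c ↭ taken ++ left → length taken ≡ length pre →
      ∑ ks (smallCache res) ≤ ∑ left p
    packing-cache av done _ _ _ _ _ left _ _ _ _ _ = ∑-nonneg left (λ i _ → 0≤p i)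
    packing-cache av {k ∷ ks} (last [] _) _ _ _ _ _ left _ _ _ _ _ =
      subst (_≤ ∑ left p) (≡.sym (idle {[]} (k ∷ ks) (λ _ _ → refl))) (∑-nonneg left (λ i _ → 0≤p i))
    packing-cache av {k ∷ ks} (last js@(f ∷ js′) _) (k∉ ∷ _) (f≥ ∷ _) pre before taken left ks≡ js≡ le cs≡ len
      with i , i∈ , xf≤p ← find (av pre ks before js′ taken left ks≡ js≡ le cs≡ len)
      with left′ , left↭ ← ∈⇒↭ i∈ = begin
        ∑ (k ∷ ks) (smallCache (map (_, k) js ++ []))
          ≡⟨ cong₂ _+_ (cong (maxℚ ∘ map x) (smallOn-here k js [])) (idle {map (_, k) js ++ []} ks (λ i i∈ → smallOn-there (All.lookup k∉ i∈) js [])) ⟩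
        maxℚ (map x (js ++ [])) + 0ℚ
          ≤⟨ ℚₚ.+-mono-≤ (max-bound (js ++ []) (0≤p i) (All.tabulate λ j∈ → below (∈-++⁻ js j∈))) (∑-nonneg left′ (λ i _ → 0≤p i)) ⟩
        p i + ∑ left′ p    ≡⟨ ∑-↭ p left↭ ⟨
        ∑ left p           ∎
      where
        open ≤-Reasoning
        below : ∀ {j} → j ∈ js ⊎ j ∈ [] → x j ≤ p i
        below (inj₁ (here refl)) = xf≤p
        below (inj₁ (there j∈)) = ℚₚ.≤-trans (All.lookup f≥ j∈) xf≤p
    -- A full core has received a small job, because its large load alone is at most 1.
    packing-cache av {k ∷ ks} (full [] lt _ _) =
      contradiction (subst (_≤ 1ℚ) (≡.sym (ℚₚ.+-identityʳ (L k))) (L≤1 k)) (<⇒≱ lt)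
    packing-cache av {k ∷ ks} (full {js = js} {res = res} block@(f ∷ block′) lt _ packed) (k∉ ∷ u) ord@(f≥ ∷ _)
                  pre before taken left ks≡ js≡ le cs≡ len
      with i , i∈ , xf≤p ← find (av pre ks before (block′ ++ js) taken left ks≡ js≡ le cs≡ len)
      with left′ , left↭ ← ∈⇒↭ i∈ = begin
        ∑ (k ∷ ks) (smallCache (map (_, k) block ++ res))
          ≡⟨ cong₂ _+_ (cong (maxℚ ∘ map x) (≡.trans (smallOn-here k block res) (cong (block ++_) (smallOn-∉ packed (λ k∈ → All.lookup k∉ k∈ refl)))))
                       (∑-cong ks {smallCache (map (_, k) block ++ res)} {smallCache res} (λ i i∈ → cong (maxℚ ∘ map x) (smallOn-there (All.lookup k∉ i∈) block res))) ⟩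
        maxℚ (map x (block ++ [])) + ∑ ks (smallCache res)
          ≤⟨ ℚₚ.+-mono-≤ (max-bound (block ++ []) (0≤p i) (All.tabulate λ j∈ → below (∈-++⁻ block j∈))) rest ⟩
        p i + ∑ left′ p    ≡⟨ ∑-↭ p left↭ ⟨
        ∑ left p           ∎
      where
        open ≤-Reasoning
        below : ∀ {j} → j ∈ block ⊎ j ∈ [] → x j ≤ p i
        below (inj₁ (here refl)) = xf≤p
        below (inj₁ (there j∈)) = ℚₚ.≤-trans (All.lookup f≥ (∈-++⁺ˡ j∈)) xf≤p
        le′ : ∑ (pre ++ k ∷ []) (λ i → 1ℚ - L i) ≤ ∑ (before ++ block) a
        le′ = ≡.subst₂ _≤_ (≡.sym (∑-++ pre (k ∷ []) _)) (≡.sym (∑-++ before block a))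
          (ℚₚ.+-mono-≤ le (shift-≤ (ℚₚ.<⇒≤ lt)
            (solve 2 (λ s l → s :+ con 1ℚ := ((con 1ℚ :- l) :+ con 0ℚ) :+ (l :+ (con 0ℚ :+ s))) refl (∑ block a) (L k))))
        -- Core `i` moves from `left` to `taken`, which keeps one charged core for each core already
        -- filled.
        rest : ∑ ks (smallCache res) ≤ ∑ left′ p
        rest = packing-cache av packed u (AllPairs-++ʳ block ord) (pre ++ k ∷ []) (before ++ block) (i ∷ taken) left′
          (≡.trans ks≡ (≡.sym (++-assoc pre (k ∷ []) ks))) (≡.trans js≡ (≡.sym (++-assoc before block js))) le′
          (↭-trans cs≡ (↭-trans (++⁺ˡ taken left↭) (shift i taken left′)))
          (≡.trans (cong suc len) (≡.trans (ℕₚ.+-comm 1 (length pre)) (≡.sym (length-++ pre))))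

-- The run of the algorithm against the given schedule

module Run {n c : ℕ} {a x : Fin n → ℚ} {K : ℚ} (0<a : ∀ j → 0ℚ < a j) (0≤x : ∀ j → 0ℚ ≤ x j)
           {p : Fin c → ℚ} {S : Fin n → Fin c} (0≤p : ∀ i → 0ℚ ≤ p i) (x≤p : ∀ j → x j ≤ p (S j))
           (∑p≤K : ∑ (allFin c) p ≤ K) (makespan : ∀ i → coreLoad a S i ≤ 1ℚ)
           (ℓ : VertexLabelling n c a) (Q : PerfectMatching c (Adj ℓ)) (dom : IsDominant (vweight ℓ) Q)
           (js : List (Fin n)) (js-order : SmallOrder a x js)
           (ks : List (Fin c)) (ks-order : CoreOrder (largeLoad ℓ Q) ks) where

  open Schedule 0<a S makespan

  M : PerfectMatching c (Adj ℓ)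
  M = proj₁ (schedule-matching ℓ)

  M-respects : Respects ℓ M
  M-respects = proj₂ (schedule-matching ℓ)

  LQ LM : Fin c → ℚ
  LQ = largeLoad ℓ Q
  LM = largeLoad ℓ M

  js-unique : Unique js
  js-unique = proj₁ js-order
  js-small : ∀ j → j ∈ js → Small a j
  js-small = proj₁ (proj₂ js-order)
  js-desc : AllPairs (λ j j′ → x j′ ≤ x j) js
  js-desc = Linked⇒AllPairs (λ y≥z x≥y → ℚₚ.≤-trans x≥y y≥z) (proj₂ (proj₂ (proj₂ js-order)))
  ks↭ : ks ↭ allFin c
  ks↭ = proj₁ ks-order
  ks-unique : Unique ks
  ks-unique = Unique-resp-↭ (↭-sym ks↭) (allFin⁺ c)
  ks-asc : AllPairs (λ k k′ → LQ k ≤ LQ k′) ks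
  ks-asc = Linked⇒AllPairs ℚₚ.≤-trans (proj₂ ks-order)

  LQ≤1 : ∀ k → LQ k ≤ 1ℚ
  LQ≤1 k = proj₂ (isEdge Q k)

  open Packings a LQ
  open Cache x LQ≤1 p 0≤p ks js

  -- `Q` and `M` have the same total weight and hence leave the same total room, and the schedule
  -- fits all small jobs beside `M`.
  capacity : 0ℚ + ∑ js a ≤ ∑ ks (λ k → 1ℚ - LQ k)
  capacity = begin
    0ℚ + ∑ js a                                      ≡⟨ ℚₚ.+-identityˡ (∑ js a) ⟩
    ∑ js a                                           ≤⟨ small-load-total ℓ {M = M} M-respects js-unique js-small (allFin⁺ c) (λ j _ → ∈-allFin (S j)) ⟩
    ∑ (allFin c) (λ i → 1ℚ - LM i)                   ≡⟨ slack M ⟩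
    ∑ (allFin c) (const 1ℚ) - ∑ (allFin (2 ℕ.* c)) (vweight ℓ) ≡⟨ slack Q ⟨
    ∑ (allFin c) (λ i → 1ℚ - LQ i)                   ≡⟨ ∑-↭ (λ k → 1ℚ - LQ k) ks↭ ⟨
    ∑ ks (λ k → 1ℚ - LQ k)                           ∎
    where
      open ≤-Reasoning
      slack : ∀ N → ∑ (allFin c) (λ i → 1ℚ - largeLoad ℓ N i) ≡ ∑ (allFin c) (const 1ℚ) - ∑ (allFin (2 ℕ.* c)) (vweight ℓ)
      slack N = ≡.trans (∑-- (allFin c) (const 1ℚ) (largeLoad ℓ N))
        (cong (λ s → ∑ (allFin c) (const 1ℚ) - s) (∑-endpoints N (vweight ℓ)))

  -- Otherwise the given schedule would fit all the small jobs up to f on the cores taken, of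
  -- which there are as many as cores before k; but these are filled beyond 1, and by
  -- dominance no perfect matching leaves more room on that number of cores.
  available : Available
  available {k} {f} pre ks′ before js′ taken left ks≡ js≡ le cs≡ len
    with any? (λ i → x f ℚₚ.≤? p i) left
  ... | yes found = found
  ... | no none = contradiction room (<⇒≱ (begin-strict
      ∑ pre (λ i → 1ℚ - LQ i)        ≤⟨ le ⟩
      ∑ before a                     <⟨ before< ⟩
      ∑ upto a                       ∎))
    where
      open ≤-Reasoning
      -- With the load of `k` as threshold, the cores `pre` lie at or below `t` and all others at or
      -- above it, so the positive parts of `t - LQ i` sum to the slack of `pre`.
      t : ℚ
      t = LQ k
      upto : List (Fin n)
      upto = before ++ f ∷ []

      before< : ∑ before a < ∑ upto a
      before< = begin-strict
        ∑ before a                   ≡⟨ ℚₚ.+-identityʳ _ ⟨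
        ∑ before a + 0ℚ              <⟨ ℚₚ.+-monoʳ-< (∑ before a) (ℚₚ.+-mono-<-≤ (0<a f) ℚₚ.≤-refl) ⟩
        ∑ before a + ∑ (f ∷ []) a    ≡⟨ ∑-++ before (f ∷ []) a ⟨
        ∑ upto a                     ∎

      js≡′ : js ≡ upto ++ js′
      js≡′ = ≡.trans js≡ (≡.sym (++-assoc before (f ∷ []) js′))
      upto-unique : Unique upto
      upto-unique = AllPairs-++ˡ upto (subst Unique js≡′ js-unique)
      upto-small : ∀ j → j ∈ upto → Small a j
      upto-small j j∈ = js-small j (subst (j ∈_) (≡.sym js≡′) (∈-++⁺ˡ j∈))
      demand : ∀ {j} → j ∈ before ⊎ j ∈ f ∷ [] → x f ≤ x j
      demand (inj₁ j∈) = AllPairs-cross before (subst (AllPairs _) js≡ js-desc) j∈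
      demand (inj₂ (here refl)) = ℚₚ.≤-refl
      -- Jobs up to `f` demand at least `x f`, and by assumption no core in `left` has that much
      -- cache.
      on-taken : ∀ j → j ∈ upto → S j ∈ taken
      on-taken j j∈ with ∈-++⁻ taken (∈-resp-↭ cs≡ (∈-allFin (S j)))
      ... | inj₁ S∈ = S∈
      ... | inj₂ S∈ = contradiction (lose S∈ (ℚₚ.≤-trans (demand (∈-++⁻ before j∈)) (x≤p j))) none

      pos-LQ : ∑ ks (λ i → pos (t - LQ i)) ≡ ∑ pre (λ i → t - LQ i)
      pos-LQ = ≡.trans (cong (λ is → ∑ is g) ks≡) (≡.trans (∑-++ pre (k ∷ ks′) g) (≡.trans (cong₂ _+_
          (∑-cong pre (λ i i∈ → 0≤p⇒pos≡p (p≤q⇒0≤q-p (AllPairs-cross pre asc i∈))))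
          (≡.trans (∑-cong (k ∷ ks′) {g} {const 0ℚ} (λ i i∈ → p≤0⇒pos≡0 (p≤q⇒p-q≤0 (after i∈)))) (zeros (k ∷ ks′))))
          (ℚₚ.+-identityʳ _)))
        where
          g : Fin c → ℚ
          g i = pos (t - LQ i)
          asc : AllPairs (λ k k′ → LQ k ≤ LQ k′) (pre ++ k ∷ ks′)
          asc = subst (AllPairs _) ks≡ ks-asc
          after : ∀ {i} → i ∈ k ∷ ks′ → t ≤ LQ i
          after (here refl) = ℚₚ.≤-refl
          after (there i∈) = case AllPairs-++ʳ pre asc of λ { (t≤ ∷ _) → All.lookup t≤ i∈ }
          zeros : ∀ (is : List (Fin c)) → ∑ is (const 0ℚ) ≡ 0ℚ
          zeros [] = refl
          zeros (_ ∷ is) = ≡.trans (ℚₚ.+-identityˡ _) (zeros is)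

      -- Writing `1ℚ - L i` as `(1ℚ - t) + (t - L i)` leaves a first part that depends only on the
      -- number of cores, equal for `taken` and `pre`, and a second part that dominance controls.
      room : ∑ upto a ≤ ∑ pre (λ i → 1ℚ - LQ i)
      room = begin
        ∑ upto a
          ≤⟨ small-load-total ℓ {M = M} M-respects upto-unique upto-small
               (AllPairs-++ˡ taken (Unique-resp-↭ cs≡ (allFin⁺ c))) on-taken ⟩
        ∑ taken (λ i → 1ℚ - LM i)
          ≡⟨ split taken LM ⟩
        ∑ taken (const (1ℚ - t)) + ∑ taken (λ i → t - LM i)
          ≤⟨ ℚₚ.+-mono-≤ (ℚₚ.≤-reflexive constants) (∑-mono taken (λ i _ → p≤pos (t - LM i))) ⟩
        ∑ pre (const (1ℚ - t)) + ∑ taken (λ i → pos (t - LM i))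
          ≤⟨ ℚₚ.+-monoʳ-≤ (∑ pre (const (1ℚ - t))) slack≤ ⟩
        ∑ pre (const (1ℚ - t)) + ∑ pre (λ i → t - LQ i)
          ≡⟨ split pre LQ ⟨
        ∑ pre (λ i → 1ℚ - LQ i)  ∎
        where
          split : ∀ is (L : Fin c → ℚ) → ∑ is (λ i → 1ℚ - L i) ≡ ∑ is (const (1ℚ - t)) + ∑ is (λ i → t - L i)
          split is L = ≡.trans
            (∑-cong is (λ i _ → solve 2 (λ t l → con 1ℚ :- l := (con 1ℚ :- t) :+ (t :- l)) refl t (L i)))
            (∑-+ is (const (1ℚ - t)) (λ i → t - L i))
          constants : ∑ taken (const (1ℚ - t)) ≡ ∑ pre (const (1ℚ - t))
          constants = ≡.trans (∑-const taken (1ℚ - t)) (≡.trans (cong (λ m → m · (1ℚ - t)) len) (≡.sym (∑-const pre (1ℚ - t))))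
          slack≤ : ∑ taken (λ i → pos (t - LM i)) ≤ ∑ pre (λ i → t - LQ i)
          slack≤ = begin
            ∑ taken gM                            ≤⟨ p≤p+q (∑-nonneg left (λ i _ → 0≤pos (t - LM i))) ⟩
            ∑ taken gM + ∑ left gM                ≡⟨ ∑-++ taken left gM ⟨
            ∑ (taken ++ left) gM                  ≡⟨ ∑-↭ gM cs≡ ⟨
            ∑ (allFin c) gM                       ≤⟨ dominant-slack {w = vweight ℓ} Q M (dom M) t ⟩
            ∑ (allFin c) (λ i → pos (t - LQ i))   ≡⟨ ∑-↭ (λ i → pos (t - LQ i)) ks↭ ⟨
            ∑ ks (λ i → pos (t - LQ i))           ≡⟨ pos-LQ ⟩
            ∑ pre (λ i → t - LQ i)                ∎
            where
              gM : Fin c → ℚ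
              gM i = pos (t - LM i)

  0≤atVertex : ∀ v → 0ℚ ≤ atVertex ℓ x v
  0≤atVertex v with label ℓ v
  ... | just j = 0≤x j
  ... | nothing = ℚₚ.≤-refl

  end-demand : ∀ {i v} → v ∈ ends ℓ M i → atVertex ℓ x v ≤ p i
  end-demand {i} {v} v∈ with label ℓ v in eq
  ... | just j = subst (λ i → x j ≤ p i) (M-respects v∈ eq) (x≤p j)
  ... | nothing = 0≤p i

  -- The total demand of all vertices is independent of the matching. Evaluated along `M`, both
  -- endpoints of edge i demand at most `p i`.
  large-cache : ∑ (allFin c) (λ i → edgeWeight {c} (atVertex ℓ x) (edge Q i)) ≤ ∑ (allFin c) p + ∑ (allFin c) p
  large-cache = begin
    ∑ (allFin c) (λ i → edgeWeight {c} (atVertex ℓ x) (edge Q i))  ≡⟨ ∑-endpoints Q (atVertex ℓ x) ⟩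
    ∑ (allFin (2 ℕ.* c)) (atVertex ℓ x)                            ≡⟨ ∑-endpoints M (atVertex ℓ x) ⟨
    ∑ (allFin c) (λ i → edgeWeight {c} (atVertex ℓ x) (edge M i))
      ≤⟨ ∑-mono (allFin c) (λ i _ → ℚₚ.+-mono-≤ (end-demand {i} (here refl)) (end-demand {i} (there (here refl)))) ⟩
    ∑ (allFin c) (λ i → p i + p i)                                 ≡⟨ ∑-+ (allFin c) p p ⟩
    ∑ (allFin c) p + ∑ (allFin c) p                                ∎
    where open ≤-Reasoning

  -- Demands are non-negative, so the maximum is at most the sum. This separates the large jobs, at
  -- cost 2K, from the small ones, at cost K.
  cache≤ : ∀ res i → finalCache ℓ Q x res i ≤ edgeWeight {c} (atVertex ℓ x) (edge Q i) + smallCache res i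
  cache≤ res i = ⊔≤+ (ℚₚ.≤-trans (0≤atVertex u) (ℚₚ.p≤p⊔q _ _)) (0≤maxℚ (smallOn res i))
      (⊔≤+ (0≤atVertex u) (0≤atVertex v) ℚₚ.≤-refl ℚₚ.≤-refl) ℚₚ.≤-refl
    where
      u = proj₁ (edge Q i)
      v = proj₂ (edge Q i)
      ⊔≤+ : ∀ {q r q′ r′} → 0ℚ ≤ q → 0ℚ ≤ r → q ≤ q′ → r ≤ r′ → q ⊔ r ≤ q′ + r′
      ⊔≤+ 0≤q 0≤r q≤q′ r≤r′ = ℚₚ.⊔-lub
        (ℚₚ.≤-trans q≤q′ (p≤p+q (ℚₚ.≤-trans 0≤r r≤r′)))
        (ℚₚ.≤-trans r≤r′ (p≤q+p (ℚₚ.≤-trans 0≤q q≤q′)))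
      0≤maxℚ : ∀ is → 0ℚ ≤ maxℚ (map x is)
      0≤maxℚ [] = ℚₚ.≤-refl
      0≤maxℚ (i ∷ is) = ℚₚ.≤-trans (0≤maxℚ is) (ℚₚ.p≤q⊔p (x i) _)

  good-run : GoodRun a x K ℓ Q ks js
  good-run =
    let res , eq , packed = greedy-packs LQ≤1 0<a ks 0ℚ js ℚₚ.≤-refl (fresh LQ≤1 ks) js-small capacity in
    res , eq , packing-load (λ k → ℚₚ.≤-trans (LQ≤1 k) (ℚₚ.≤ᵇ⇒≤ _)) ks-unique packed , (begin
      ∑ (allFin c) (finalCache ℓ Q x res)
        ≤⟨ ∑-mono (allFin c) (λ i _ → cache≤ res i) ⟩
      ∑ (allFin c) (λ i → edgeWeight {c} (atVertex ℓ x) (edge Q i) + smallCache res i)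
        ≡⟨ ∑-+ (allFin c) _ (smallCache res) ⟩
      ∑ (allFin c) (λ i → edgeWeight {c} (atVertex ℓ x) (edge Q i)) + ∑ (allFin c) (smallCache res)
        ≤⟨ ℚₚ.+-mono-≤ large-cache (ℚₚ.≤-trans (ℚₚ.≤-reflexive (≡.sym (∑-↭ (smallCache res) ks↭)))
             (packing-cache available packed ks-unique js-desc [] [] [] (allFin c) refl refl ℚₚ.≤-refl ↭-refl refl)) ⟩
      ∑ (allFin c) p + ∑ (allFin c) p + ∑ (allFin c) p
        ≤⟨ ℚₚ.+-mono-≤ (ℚₚ.+-mono-≤ ∑p≤K ∑p≤K) ∑p≤K ⟩
      K + K + K
        ≡⟨ solve 1 (λ k → k :+ k :+ k := con three :* k) refl K ⟩
      three * K  ∎)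
    where open ≤-Reasoning

-- The three components rule out failure in the order of the steps: too many large jobs, no dominant
-- matching, and too few cores or too much cache. The last holds for every choice the algorithm
-- leaves open.
theorem7 : (n c : ℕ) (a x : Fin n → ℚ) (K : ℚ) →
    (∀ j → 0ℚ < a j) → (∀ j → 0ℚ ≤ x j) →
    Solution n c a x K 1ℚ →
    VertexLabelling n c a
    × ((ℓ : VertexLabelling n c a) →
    Σ (PerfectMatching c (Adj ℓ)) (IsDominant (vweight ℓ)))
    × ((ℓ : VertexLabelling n c a) (Q : PerfectMatching c (Adj ℓ)) →
    IsDominant (vweight ℓ) Q →
    (js : List (Fin n)) → SmallOrder a x js →
    (ks : List (Fin c)) → CoreOrder (largeLoad ℓ Q) ks →
    GoodRun a x K ℓ Q ks js)
theorem7 n c a x K 0<a 0≤x (p , S , 0≤p , x≤p , ∑p≤K , makespan) =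
  labelling ,
  (λ ℓ → dominant-exists {w = vweight ℓ} (proj₁ (schedule-matching ℓ))) ,
  Run.good-run 0<a 0≤x 0≤p x≤p ∑p≤K makespan
  where open Schedule 0<a S makespan
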